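{- Let $G$ be a prime tournament. Then $G$ is $U_5$-free if and only if either $G$ is isomorphic to $T_n$ for some odd $n \ge 1$, or $V(G)$ can be partitioned into sets $X$, $Y$, $Z$ (some possibly empty) such that $X \cup Y$, $Y \cup Z$, and $Z \cup X$ are each transitive.
   Context: A tournament is a finite loopless directed graph in which for any two distinct vertices $u,v$ there is exactly one edge between them; write $u \rightarrow v$ for the edge from $u$ to $v$. A subtournament is a tournament induced on a subset of vertices. For tournaments $G,H$, $G$ is $H$-free if no subtournament of $G$ is isomorphic to $H$. A set $S \subseteq V(G)$ is transitive if the induced subtournament has no cyclic triangle (three vertices $a\rightarrow b\rightarrow c\rightarrow a$). A homogeneous set of $G$ is a set $X \subseteq V(G)$ such that every $v \in V(G)\setminus X$ satisfies either $v \rightarrow x$ for all $x \in X$ or $x \rightarrow v$ for all $x \in X$; it is nontrivial if $1<|X|<|V(G)|$. $G$ is prime if it has no nontrivial homogeneous set. For odd $n\ge1$, $T_n$ is the tournament on $v_1,\dots,v_n$ with $v_i \rightarrow v_j$ iff $j-i \equiv 1,2,\dots,(n-1)/2 \pmod n$. $U_5$ is the tournament on $v_1,\dots,v_5$ with $v_2 \rightarrow v_1$, and $v_i \rightarrow v_j$ whenever $j-i\equiv 1,2 \pmod 5$ and $\{i,j\}\neq\{1,2\}$. -}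

module Defs where

open import Data.Nat using (ℕ; zero; suc; _+_; _*_; _∸_; _<_; _≤_)
open import Data.Nat.DivMod using (_%_)
open import Data.Bool using (Bool; true; false; _∧_; if_then_else_)
open import Data.Nat using (_≤ᵇ_; _≡ᵇ_)
open import Data.Fin using (Fin; toℕ)
open import Data.Fin.Subset using (Subset; _∈_; _∉_; ∣_∣)
open import Data.Product using (Σ; ∃; _×_; _,_)
open import Data.Sum using (_⊎_)
open import Relation.Binary.PropositionalEquality using (_≡_; _≢_)
open import Relation.Nullary using (¬_)
open import Function.Bundles using (_⤖_; Bijection)
open import Function.Definitions using (Injective)

record Digraph : Set where
  constructor mkDigraph
  field
    n : ℕ
    E : Fin n → Fin n → Bool
open Digraph public

_∶_⇒_ : (G : Digraph) → Fin (n G) → Fin (n G) → Set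
G ∶ u ⇒ v = E G u v ≡ true

IsTournament : Digraph → Set
IsTournament G =
  (∀ u → ¬ (G ∶ u ⇒ u)) ×
  (∀ u v → u ≢ v → (G ∶ u ⇒ v) ⊎ (G ∶ v ⇒ u)) ×
  (∀ u v → G ∶ u ⇒ v → ¬ (G ∶ v ⇒ u))

_≅_ : Digraph → Digraph → Set
G ≅ H = Σ (Fin (n G) ⤖ Fin (n H)) λ f →
  ∀ u v → E G u v ≡ E H (Bijection.to f u) (Bijection.to f v)

Contains : Digraph → Digraph → Set
Contains G H = Σ (Fin (n H) → Fin (n G)) λ f →
  Injective _≡_ _≡_ f × (∀ a b → E H a b ≡ E G (f a) (f b))

Free : Digraph → Digraph → Set
Free H G = ¬ Contains G H

Homogeneous : (G : Digraph) → Subset (n G) → Set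
Homogeneous G X = ∀ v → v ∉ X →
  (∀ x → x ∈ X → G ∶ v ⇒ x) ⊎ (∀ x → x ∈ X → G ∶ x ⇒ v)

Nontrivial : (G : Digraph) → Subset (n G) → Set
Nontrivial G X = (1 < ∣ X ∣) × (∣ X ∣ < n G)

Prime : Digraph → Set
Prime G = ∀ X → Homogeneous G X → ¬ Nontrivial G X

TransitiveSet : (G : Digraph) → (Fin (n G) → Set) → Set
TransitiveSet G S = ∀ a b c → S a → S b → S c →
  ¬ ((G ∶ a ⇒ b) × (G ∶ b ⇒ c) × (G ∶ c ⇒ a))

-- T_n for n = 2k+1, vertices v_1..v_n represented by 0..n-1:
-- i → j iff (j - i) mod n ∈ {1,…,k}.
T : (k : ℕ) → Digraph
T k = mkDigraph (suc (k + k)) λ i j →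
  let d = (toℕ j + suc (k + k) ∸ toℕ i) % suc (k + k)
  in (1 ≤ᵇ d) ∧ (d ≤ᵇ k)

-- U_5: vertices v_1..v_5 represented by 0..4; v_2 → v_1, otherwise as T_5.
U5 : Digraph
U5 = mkDigraph 5 λ i j →
  if (toℕ i ≡ᵇ 1) ∧ (toℕ j ≡ᵇ 0) then true
  else if (toℕ i ≡ᵇ 0) ∧ (toℕ j ≡ᵇ 1) then false
  else E (T 2) i j

{-# OPTIONS --safe --termination-depth=2 #-}
module Submission where

-- Three facts about a prime tournament G without U₅ give the theorem.  All of them are proved by
-- growing a strongly connected set S: by primality some vertex v ∉ S has both an out- and an
-- in-neighbour in S, it then has both in some triangle of S, and S ∪ {v} is strong again.
-- (1) G does not contain D₅, the triangle with one vertex replaced by a triangle: if x → S → y → x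
-- for a triangle S, then x → v → y for each added vertex v.
-- (2) If G contains T₅, then every triangle lies in a T₅, and a vertex dominating a triangle would
-- dominate everything.  So G is locally transitive; reversing the edges between the two
-- neighbourhoods of a vertex then gives a linear order, along which primality forces the two
-- neighbourhoods to alternate, as in T_n.
-- (3) Otherwise the 3-colouring of S extends to v, that is, all edges a → b of S with v → a → b → v
-- carry the same ordered pair of colours.  For two edges with a common tail a, the colours of the
-- heads are compared along a shortest path of S from one head to a; edges with a common head are
-- dual, and edges a → b, a′ → b′ joined by neither a → b′ nor a′ → b would form a U₅ or D₅ with v.

open import Defs
open import Data.Bool using (Bool; true; false; _∧_; _∨_; not)
import Data.Bool as Bool
open import Data.Bool.ListAction using (any)
open import Data.Bool.Properties using (¬-not; T-≡)
open import Data.Empty using (⊥; ⊥-elim)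
open import Data.Fin using (Fin; zero; suc; toℕ; fromℕ<)
import Data.Fin as Fin
open import Data.Fin.Patterns
open import Data.Fin.Properties using (all?; any?; injective⇒≤; toℕ<n; toℕ-fromℕ<)
open import Data.Fin.Subset using (Subset; _∈_; _∉_; _⊆_; ∣_∣; _∪_; ⁅_⁆)
open import Data.Fin.Subset.Properties
  using (_∈?_; p⊂q⇒∣p∣<∣q∣; ∣p∣≤n; ∣⊤∣≡n; ∈⊤; ⊆⊤; p⊆p∪q; q⊆p∪q; x∈p∪q⁻; x∈⁅x⁆; x∈⁅y⁆⇒x≡y; ∣⁅x⁆∣≡1)
open import Data.List using (List; []; _∷_; filterᵇ; upTo; map)
open import Data.List.Relation.Unary.All as All using (All; []; _∷_)
open import Data.Nat using (ℕ; zero; suc; _+_; _∸_; _≤_; _<_; s≤s; _≡ᵇ_; _≤ᵇ_)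
open import Data.Nat.DivMod using (_%_; _mod_; m<n⇒m%n≡m; [m+n]%n≡m%n)
open import Data.Nat.Induction using (<-rec)
open import Data.Nat.Properties
open import Data.Product using (Σ; ∃; _×_; _,_; proj₁; proj₂; map₂)
open import Data.Sum as Sum using (_⊎_; inj₁; inj₂; [_,_]′)
open import Data.Unit using () renaming (⊤ to Unit)
open import Data.Vec as Vec using (Vec)
open import Data.Vec.Functional using (updateAt)
open import Data.Vec.Functional.Properties using (updateAt-updates; updateAt-minimal)
open import Data.Vec.Properties using (lookup∘tabulate; lookup⇒[]=; []=⇒lookup)
open import Function using (_∘_; case_of_; Injective)
open import Function.Bundles using (_⇔_; mk⇔; mk⤖; Bijection; Equivalence)
open import Relation.Binary.PropositionalEquality
open import Relation.Nullary
open import Relation.Nullary.Decidable using (toWitness; does; dec-true; decidable-stable; map′)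

-- Between tournaments an edge-preserving map is already an embedding (`hom-embeds`), so a copy of a
-- forbidden tournament is given by its edges alone.
Hom : Digraph → Digraph → Set
Hom H G = Σ (Fin (n H) → Fin (n G)) λ f → ∀ {i j} → H ∶ i ⇒ j → G ∶ f i ⇒ f j

-- Refutation by search for forbidden subtournaments

Edges : Set
Edges = List (ℕ × ℕ)

known : Edges → ℕ → ℕ → Bool
known es i j = any (λ (a , b) → (a ≡ᵇ i) ∧ (b ≡ᵇ j)) es

-- The last argument lists, for every remaining vertex of the pattern, the images that are
-- compatible with the choices made so far.
embeds : ∀ m → (Fin m → Fin m → Bool) → (ℕ → ℕ → Bool) → Vec (List ℕ) m → Bool
embeds zero    H K C = true
embeds (suc m) H K C =
  not (H zero zero) ∧
  any (λ x → embeds m (λ i j → H (suc i) (suc j)) K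
        (Vec.tabulate λ i → filterᵇ
          (λ y → (not (H zero (suc i)) ∨ K x y) ∧ (not (H (suc i) zero) ∨ K y x))
          (Vec.lookup C (suc i))))
      (Vec.head C)

found : List Digraph → ℕ → Edges → Bool
found Hs k es =
  any (λ H → embeds (n H) (E H) (known es) (Vec.replicate (n H) (upTo k))) Hs

distinguished : ℕ → Edges → ℕ → ℕ → Bool
distinguished k es i j =
  any (λ l → (known es i l ∧ known es l j) ∨ (known es j l ∧ known es l i)) (upTo k)

-- es lists the known edges between vertices 0, …, k − 1 of a tournament, and ps the pairs to branch
-- on.  The numbers may stand for equal vertices; a pair is branched on only after a known path of
-- length two has shown its ends to be distinct.
refute : List Digraph → ℕ → Edges → Edges → Bool
refute Hs k es []             = found Hs k es
refute Hs k es ((i , j) ∷ ps) =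
  found Hs k es ∨
  (distinguished k es i j ∧ refute Hs k ((i , j) ∷ es) ps ∧ refute Hs k ((j , i) ∷ es) ps)

∧-elim : ∀ {x y} → x ∧ y ≡ true → x ≡ true × y ≡ true
∧-elim {true} {true} _ = refl , refl

∨-elim : ∀ {x y} → x ∨ y ≡ true → x ≡ true ⊎ y ≡ true
∨-elim {true}  _ = inj₁ refl
∨-elim {false} p = inj₂ p

any-elim : ∀ {A : Set} (p : A → Bool) xs → any p xs ≡ true →
  ∃ λ x → p x ≡ true × (∀ {P : A → Set} → All P xs → P x)
any-elim p (x ∷ xs) eq with ∨-elim {p x} eq
... | inj₁ px = x , px , λ { (q ∷ _) → q }
... | inj₂ pxs with any-elim p xs pxs
...   | y , py , pick = y , py , λ { (_ ∷ qs) → pick qs }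

filter-all : ∀ {A : Set} (p : A → Bool) {P : A → Set} xs → All P xs →
  All (λ x → p x ≡ true × P x) (filterᵇ p xs)
filter-all p []       []       = []
filter-all p (x ∷ xs) (q ∷ qs) with p x in eq
... | true  = (eq , q) ∷ filter-all p xs qs
... | false = filter-all p xs qs

implies : ∀ {x y} → not x ∨ y ≡ true → x ≡ true → y ≡ true
implies p refl = p

embeds-sound : ∀ m H K (C : Vec (List ℕ) m) {P : Fin m → ℕ → Set} →
  embeds m H K C ≡ true → (∀ i → All (P i) (Vec.lookup C i)) →
  Σ (Fin m → ℕ) λ f → (∀ i → P i (f i)) × (∀ {i j} → H i j ≡ true → K (f i) (f j) ≡ true)
embeds-sound zero    H K C eq all = (λ ()) , (λ ()) , λ { {()} }
embeds-sound (suc m) H K (xs Vec.∷ C) {P} eq all = g , gP , gE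
  where
  H₀₀ = proj₁ (∧-elim eq)
  step = any-elim _ xs (proj₂ (∧-elim {not (H zero zero)} eq))
  x = proj₁ step

  p : Fin m → ℕ → Bool
  p i y = (not (H zero (suc i)) ∨ K x y) ∧ (not (H (suc i) zero) ∨ K y x)

  rec = embeds-sound m _ K _ {λ i y → p i y ≡ true × P (suc i) y} (proj₁ (proj₂ step))
    λ i → subst (All _) (sym (lookup∘tabulate _ i)) (filter-all (p i) _ (all (suc i)))

  g : Fin (suc m) → ℕ
  g zero    = x
  g (suc i) = proj₁ rec i

  gP : ∀ i → P i (g i)
  gP zero    = proj₂ (proj₂ step) (all zero)
  gP (suc i) = proj₂ (proj₁ (proj₂ rec) i)

  compat = λ i → ∧-elim {not (H zero (suc i)) ∨ K x (g (suc i))} (proj₁ (proj₁ (proj₂ rec) i))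

  gE : ∀ {i j} → H i j ≡ true → K (g i) (g j) ≡ true
  gE {zero}  {zero}  h = case trans (sym H₀₀) (cong not h) of λ ()
  gE {zero}  {suc j} h = implies (proj₁ (compat j)) h
  gE {suc i} {zero}  h = implies (proj₂ (compat i)) h
  gE {suc i} {suc j} h = proj₂ (proj₂ rec) h

D5 : Digraph
D5 = mkDigraph 5 λ i j → known
  ( (0 , 1) ∷ (1 , 2) ∷ (2 , 0)
  ∷ (3 , 0) ∷ (3 , 1) ∷ (3 , 2)
  ∷ (0 , 4) ∷ (1 , 4) ∷ (2 , 4) ∷ (4 , 3) ∷ [] ) (toℕ i) (toℕ j)

Rev : Digraph → Digraph
Rev G = mkDigraph (n G) λ u v → E G v u

module Tournament (G : Digraph) (tour : IsTournament G) where

  V : Set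
  V = Fin (n G)

  infix 4 _⇒_
  _⇒_ : V → V → Set
  u ⇒ v = G ∶ u ⇒ v

  irr : ∀ {u} → ¬ (u ⇒ u)
  irr = proj₁ tour _

  asym : ∀ {u v} → u ⇒ v → ¬ (v ⇒ u)
  asym = proj₂ (proj₂ tour) _ _

  data Compare (u v : V) : Set where
    same : u ≡ v → Compare u v
    fwd  : u ⇒ v → Compare u v
    bwd  : v ⇒ u → Compare u v

  compare : ∀ u v → Compare u v
  compare u v with u Fin.≟ v
  ... | yes eq = same eq
  ... | no neq with proj₁ (proj₂ tour) u v neq
  ...   | inj₁ e = fwd e
  ...   | inj₂ e = bwd e

  _⇒?_ : ∀ u v → Dec (u ⇒ v)
  u ⇒? v = E G u v Bool.≟ true

  known-sound : ∀ (ρ : ℕ → V) es i j → All (λ e → ρ (proj₁ e) ⇒ ρ (proj₂ e)) es →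
    known es i j ≡ true → ρ i ⇒ ρ j
  known-sound ρ es i j holds k with any-elim _ es k
  ... | (a , b) , eq , pick with ∧-elim {a ≡ᵇ i} eq
  ...   | eq₁ , eq₂ = subst₂ (λ x y → ρ x ⇒ ρ y)
            (≡ᵇ⇒≡ a i (subst Bool.T (sym eq₁) _)) (≡ᵇ⇒≡ b j (subst Bool.T (sym eq₂) _)) (pick holds)

  refute-sound : ∀ {Hs k} (ρ : ℕ → V) es ps → refute Hs k es ps ≡ true →
    All (λ H → ¬ Hom H G) Hs → All (λ e → ρ (proj₁ e) ⇒ ρ (proj₂ e)) es → ⊥
  found-sound : ∀ {Hs k} (ρ : ℕ → V) es → found Hs k es ≡ true →
    All (λ H → ¬ Hom H G) Hs → All (λ e → ρ (proj₁ e) ⇒ ρ (proj₂ e)) es → ⊥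
  found-sound {Hs} {k} ρ es eq free holds with any-elim _ Hs eq
  ... | H , emb , pick with embeds-sound (n H) (E H) (known es) _ {λ _ _ → Unit} emb (λ i → All.tabulate _)
  ...   | f , _ , fE = pick free (ρ ∘ f , λ h → known-sound ρ es _ _ holds (fE h))
  refute-sound ρ es [] eq free holds = found-sound ρ es eq free holds
  refute-sound {Hs} {k} ρ es ((i , j) ∷ ps) eq free holds with ∨-elim {found Hs k es} eq
  ... | inj₁ eq′ = found-sound ρ es eq′ free holds
  ... | inj₂ eq′ with ∧-elim {distinguished k es i j} eq′
  ...   | dist , eq″ with ∧-elim {refute Hs k ((i , j) ∷ es) ps} eq″ | compare (ρ i) (ρ j)
  ...     | r₁ , r₂ | fwd e = refute-sound ρ ((i , j) ∷ es) ps r₁ free (e ∷ holds)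
  ...     | r₁ , r₂ | bwd e = refute-sound ρ ((j , i) ∷ es) ps r₂ free (e ∷ holds)
  -- If the two ends coincided, the known path of length two between them would consist of two
  -- opposite edges.
  ...     | r₁ , r₂ | same i≡j with any-elim _ (upTo k) dist
  ...       | l , eq‴ , _ with ∨-elim {known es i l ∧ known es l j} eq‴
  ...         | inj₁ il∧lj = case ∧-elim {known es i l} il∧lj of λ (il , lj) →
                  asym (known-sound ρ es i l holds il) (subst (ρ l ⇒_) (sym i≡j) (known-sound ρ es l j holds lj))
  ...         | inj₂ jl∧li = case ∧-elim {known es j l} jl∧li of λ (jl , li) →
                  asym (known-sound ρ es j l holds jl) (subst (ρ l ⇒_) i≡j (known-sound ρ es l i holds li))

  -- Numbers beyond the list fall back on its last vertex; no search uses such a number.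
  at : V → List V → ℕ → V
  at x xs       zero    = x
  at x []       (suc i) = x
  at x (y ∷ ys) (suc i) = at y ys i

  Facts : (ℕ → V) → Set
  Facts ρ = List (Σ (ℕ × ℕ) λ (i , j) → ρ i ⇒ ρ j)

  -- The search sees only the numbers, so `refute` evaluates on closed terms and `refl` serves as
  -- last argument; the evidence for the edges enters through `fs`.
  by-search : ∀ {Hs} k (ρ : ℕ → V) → All (λ H → ¬ Hom H G) Hs → (fs : Facts ρ) (ps : Edges) →
    refute Hs k (map proj₁ fs) ps ≡ true → ⊥
  by-search k ρ free fs ps eq = refute-sound ρ (map proj₁ fs) ps eq free (holds fs)
    where
    holds : ∀ fs → All (λ e → ρ (proj₁ e) ⇒ ρ (proj₂ e)) (map proj₁ fs)
    holds []             = []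
    holds ((_ , e) ∷ fs) = e ∷ holds fs

  -- Growing strong sets

  -- Membership in `S` is recorded for every vertex after the first. The length is an index because
  -- later inductions run on it.
  data Path (S : Subset (n G)) : ℕ → V → V → Set where
    []  : ∀ {x} → Path S 0 x x
    _∷_ : ∀ {m x y z} → x ⇒ y × y ∈ S → Path S m y z → Path S (suc m) x z

  Strong : Subset (n G) → Set
  Strong S = ∀ {x y} → x ∈ S → y ∈ S → ∃ λ m → Path S m x y

  weaken : ∀ {S S′ m x y} → S ⊆ S′ → Path S m x y → Path S′ m x y
  weaken S⊆S′ []              = []
  weaken S⊆S′ ((e , y∈S) ∷ p) = (e , S⊆S′ y∈S) ∷ weaken S⊆S′ p

  _∷ʳ_ : ∀ {S m x y z} → Path S m x y → y ⇒ z × z ∈ S → Path S (suc m) x z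
  []      ∷ʳ e = e ∷ []
  (f ∷ p) ∷ʳ e = f ∷ (p ∷ʳ e)

  insert : V → Subset (n G) → Subset (n G)
  insert v S = S ∪ ⁅ v ⁆

  data Insert (v : V) (S : Subset (n G)) : V → Set where
    new : Insert v S v
    old : ∀ {x} → x ∈ S → Insert v S x

  ∈insert : ∀ {v S x} → x ∈ insert v S → Insert v S x
  ∈insert {v} {S} x∈ with x∈p∪q⁻ S ⁅ v ⁆ x∈
  ... | inj₁ x∈S = old x∈S
  ... | inj₂ x∈v with x∈⁅y⁆⇒x≡y v x∈v
  ...   | refl = new

  ⊆insert : ∀ {v S} → S ⊆ insert v S
  ⊆insert {v} {S} = p⊆p∪q {p = S} ⁅ v ⁆

  v∈insert : ∀ {v S} → v ∈ insert v S
  v∈insert {v} {S} = q⊆p∪q S ⁅ v ⁆ (x∈⁅x⁆ v)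

  ∣insert∣ : ∀ {v S} → v ∉ S → ∣ S ∣ < ∣ insert v S ∣
  ∣insert∣ {v} {S} v∉S = p⊂q⇒∣p∣<∣q∣ (⊆insert {v} {S} , v , v∈insert {v} {S} , v∉S)

  -- These vertices are exactly the obstructions to homogeneity of `S`.
  record Mixed (S : Subset (n G)) (v : V) : Set where
    constructor mixed
    field
      {p q} : V
      v∉S   : v ∉ S
      p∈S   : p ∈ S
      q∈S   : q ∈ S
      v⇒p   : v ⇒ p
      q⇒v   : q ⇒ v

  strong-insert : ∀ {S v} → Strong S → Mixed S v → Strong (insert v S)
  strong-insert {S} {v} str (mixed _ p∈S q∈S v⇒p q⇒v) x∈ y∈ = go (∈insert x∈) (∈insert y∈)
    where
    S⊆ = ⊆insert {v} {S}
    go : ∀ {x y} → Insert v S x → Insert v S y → ∃ λ m → Path (insert v S) m x y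
    go new       new       = 0 , []
    go new       (old y∈S) = _ , (v⇒p , S⊆ p∈S) ∷ weaken S⊆ (proj₂ (str p∈S y∈S))
    go (old x∈S) new       = _ , weaken S⊆ (proj₂ (str x∈S q∈S)) ∷ʳ (q⇒v , v∈insert {v} {S})
    go (old x∈S) (old y∈S) = _ , weaken S⊆ (proj₂ (str x∈S y∈S))

  mixed? : ∀ S v → Dec (Mixed S v)
  mixed? S v with v ∈? S | any? (λ p → (p ∈? S) ×-dec (v ⇒? p)) | any? (λ q → (q ∈? S) ×-dec (q ⇒? v))
  ... | yes v∈S | _ | _ = no λ m → Mixed.v∉S m v∈S
  ... | no v∉S | yes (_ , p∈S , v⇒p) | yes (_ , q∈S , q⇒v) = yes (mixed v∉S p∈S q∈S v⇒p q⇒v)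
  ... | _ | no ¬p | _ = no λ (mixed _ p∈S _ v⇒p _) → ¬p (_ , p∈S , v⇒p)
  ... | _ | _ | no ¬q = no λ (mixed _ _ q∈S _ q⇒v) → ¬q (_ , q∈S , q⇒v)

  unmixed⇒homogeneous : ∀ {S} → (∀ v → ¬ Mixed S v) → Homogeneous G S
  unmixed⇒homogeneous {S} none v v∉S with any? (λ p → (p ∈? S) ×-dec (v ⇒? p))
  ... | yes (p , p∈S , v⇒p) = inj₁ λ x x∈S → case compare v x of λ where
          (same refl) → ⊥-elim (v∉S x∈S)
          (fwd v⇒x)   → v⇒x
          (bwd x⇒v)   → ⊥-elim (none v (mixed v∉S p∈S x∈S v⇒p x⇒v))
  ... | no none-out = inj₂ λ x x∈S → case compare v x of λ where
          (same refl) → ⊥-elim (v∉S x∈S)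
          (fwd v⇒x)   → ⊥-elim (none-out (x , x∈S , v⇒x))
          (bwd x⇒v)   → x⇒v

  full : ∀ {S} → n G ≤ ∣ S ∣ → ∀ v → v ∈ S
  full {S} n≤ v with v ∈? S
  ... | yes v∈S = v∈S
  ... | no v∉S  = ⊥-elim (<-irrefl refl (<-≤-trans (∣insert∣ v∉S) (≤-trans (∣p∣≤n (insert v S)) n≤)))

  module _ (prime : Prime G) (Inv : Subset (n G) → Set)
    (grow : ∀ {S v} → Strong S → Mixed S v → Inv S → Inv (insert v S)) where

    -- `k` bounds the number of vertices outside `S`. While `S` is not everything, primality
    -- supplies a mixed vertex, and inserting it lowers the bound by one.
    exhaust : ∀ k {S} → n G ≤ k + ∣ S ∣ → Strong S → 1 < ∣ S ∣ → Inv S →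
      ∃ λ S′ → (∀ v → v ∈ S′) × Inv S′
    exhaust k {S} n≤ str 1<S inv with any? (mixed? S)
    ... | no none = S , full (≮⇒≥ λ S<n → prime S (unmixed⇒homogeneous λ v m → none (v , m)) (1<S , S<n)) , inv
    exhaust zero    {S} n≤ str 1<S inv | yes (v , m) = ⊥-elim (Mixed.v∉S m (full n≤ v))
    exhaust (suc k) {S} n≤ str 1<S inv | yes (v , m) =
      exhaust k
        (≤-trans n≤ (≤-trans (≤-reflexive (sym (+-suc k ∣ S ∣))) (+-monoʳ-≤ k (∣insert∣ (Mixed.v∉S m)))))
        (strong-insert str m) (<-trans 1<S (∣insert∣ (Mixed.v∉S m))) (grow str m inv)

  -- Triangles crossed by an added vertex

  Cyc : V → V → V → Set
  Cyc a b c = a ⇒ b × b ⇒ c × c ⇒ a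

  rotate : ∀ {a b c} → Cyc a b c → Cyc b c a
  rotate (ab , bc , ca) = bc , ca , ab

  -- The edges a ⇒ b of S with Cyc v a b are those leaving the out-neighbourhood of v for its
  -- in-neighbourhood.
  crossing-edge : ∀ {S m v p q} → v ∉ S → p ∈ S → v ⇒ p → q ⇒ v → Path S m p q →
    ∃ λ a → ∃ λ b → a ∈ S × b ∈ S × Cyc v a b
  crossing-edge v∉S p∈S v⇒p q⇒v [] = ⊥-elim (asym v⇒p q⇒v)
  crossing-edge {v = v} v∉S p∈S v⇒p q⇒v (_∷_ {y = y} (e , y∈S) path) with compare v y
  ... | same refl = ⊥-elim (v∉S y∈S)
  ... | fwd v⇒y   = crossing-edge v∉S y∈S v⇒y q⇒v path
  ... | bwd y⇒v   = _ , _ , p∈S , y∈S , v⇒p , e , y⇒v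

  CrossingTriangle : Subset (n G) → V → Set
  CrossingTriangle S v = ∃ λ a → ∃ λ b → ∃ λ c → (a ∈ S × b ∈ S × c ∈ S) × Cyc a b c × Cyc v a b

  -- Induction on the length of the path from b back to a. Its first two edges b ⇒ p ⇒ q either
  -- close a triangle containing a crossing edge, or leave a shorter path for the same crossing edge
  -- or for the new one a ⇒ p.
  close-edge : ∀ m {S v a b} → v ∉ S → a ∈ S → b ∈ S → Cyc v a b → Path S m b a → CrossingTriangle S v
  close-edge zero v∉S a∈S b∈S (_ , a⇒a , _) [] = ⊥-elim (irr a⇒a)
  close-edge (suc zero) v∉S a∈S b∈S (_ , ab , _) ((ba , _) ∷ []) = ⊥-elim (asym ab ba)
  close-edge (suc (suc m)) {v = v} {a} {b} v∉S a∈S b∈S (va , ab , bv)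
    (_∷_ {y = p} (bp , p∈S) (_∷_ {y = q} (pq , q∈S) path))
    with compare a p
  ... | same refl = ⊥-elim (asym ab bp)
  ... | bwd pa = a , b , p , (a∈S , b∈S , p∈S) , (ab , bp , pa) , va , ab , bv
  ... | fwd ap with compare v p
  ...   | same refl = ⊥-elim (v∉S p∈S)
  ...   | bwd pv = close-edge (suc m) v∉S a∈S p∈S (va , ap , pv) ((pq , q∈S) ∷ path)
  ...   | fwd vp with compare b q
  ...     | same refl = close-edge m v∉S a∈S b∈S (va , ab , bv) path
  ...     | fwd bq = close-edge (suc m) v∉S a∈S b∈S (va , ab , bv) ((bq , q∈S) ∷ path)
  ...     | bwd qb with compare v q
  ...       | same refl = ⊥-elim (v∉S q∈S)
  ...       | fwd vq = q , b , p , (q∈S , b∈S , p∈S) , (qb , bp , pq) , vq , qb , bv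
  ...       | bwd qv = p , q , b , (p∈S , q∈S , b∈S) , (pq , qb , bp) , vp , pq , qv

  crossing-triangle : ∀ {S v} → Strong S → Mixed S v → CrossingTriangle S v
  crossing-triangle str (mixed v∉S p∈S q∈S v⇒p q⇒v) =
    let _ , _ , a∈S , b∈S , vab = crossing-edge v∉S p∈S v⇒p q⇒v (proj₂ (str p∈S q∈S))
    in close-edge _ v∉S a∈S b∈S vab (proj₂ (str b∈S a∈S))

  triangle-set : V → V → V → Subset (n G)
  triangle-set a b c = insert c (insert b ⁅ a ⁆)

  -- The induction principle of all growth arguments below. Triangles are the smallest strong sets
  -- with more than one vertex, hence the natural start.
  triangle-ind : Prime G → (Inv : Subset (n G) → Set) →
    (∀ {S v} → Strong S → Mixed S v → Inv S → Inv (insert v S)) →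
    ∀ {a b c} → Cyc a b c → Inv (triangle-set a b c) → ∃ λ S → (∀ v → v ∈ S) × Inv S
  triangle-ind prime Inv grow {a} {b} {c} (ab , bc , ca) inv =
    exhaust prime Inv grow (n G) (m≤m+n _ _) strong 1<∣S∣ inv
    where
    S₂ = insert b ⁅ a ⁆
    S = triangle-set a b c
    a∈ : a ∈ S
    a∈ = ⊆insert {c} {S₂} (⊆insert {b} {⁅ a ⁆} (x∈⁅x⁆ a))
    b∈ : b ∈ S
    b∈ = ⊆insert {c} {S₂} (v∈insert {b} {⁅ a ⁆})
    c∈ : c ∈ S
    c∈ = v∈insert {c} {S₂}

    strong : Strong S
    strong x∈ y∈ = go (∈insert x∈) (∈insert y∈)
      where
      from-a : ∀ {y} → Insert c S₂ y → ∃ λ m → Path S m a y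
      from-a new = _ , (ab , b∈) ∷ (bc , c∈) ∷ []
      from-a (old y∈) with ∈insert y∈
      ... | new = _ , (ab , b∈) ∷ []
      ... | old y∈a with x∈⁅y⁆⇒x≡y a y∈a
      ...   | refl = _ , []
      go : ∀ {x y} → Insert c S₂ x → Insert c S₂ y → ∃ λ m → Path S m x y
      go new       y∈ = _ , (ca , a∈) ∷ proj₂ (from-a y∈)
      go (old x∈)  y∈ with ∈insert x∈
      ... | new = _ , (bc , c∈) ∷ (ca , a∈) ∷ proj₂ (from-a y∈)
      ... | old x∈a with x∈⁅y⁆⇒x≡y a x∈a
      ...   | refl = from-a y∈

    1<∣S∣ : 1 < ∣ S ∣
    1<∣S∣ = subst (_< ∣ S ∣) (∣⁅x⁆∣≡1 a)
      (p⊂q⇒∣p∣<∣q∣ ((λ x∈ → ⊆insert {c} {S₂} (⊆insert {b} {⁅ a ⁆} x∈)) , b , b∈ ,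
        λ b∈a → case x∈⁅y⁆⇒x≡y a b∈a of λ { refl → irr ab }))

  ∈triangle-set : ∀ {a b c x} → x ∈ triangle-set a b c → x ≡ a ⊎ x ≡ b ⊎ x ≡ c
  ∈triangle-set x∈ with ∈insert x∈
  ... | new = inj₂ (inj₂ refl)
  ... | old x∈₂ with ∈insert x∈₂
  ...   | new = inj₂ (inj₁ refl)
  ...   | old x∈a = inj₁ (x∈⁅y⁆⇒x≡y _ x∈a)

  -- Excluding D₅

  module _ (prime : Prime G) (noU5 : ¬ Hom U5 G) where

    private
      -- A wrong direction between v and x, or between v and y, produces a U₅ among the six
      -- vertices, whichever way v is joined to c and to the other of x and y.
      dominated-extends : ∀ {x y a b c v} →
        (∀ {s} → s ≡ a ⊎ s ≡ b ⊎ s ≡ c → x ⇒ s × s ⇒ y) → y ⇒ x →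
        Cyc a b c → Cyc v a b → x ⇒ v × v ⇒ y
      dominated-extends {x} {y} {a} {b} {c} {v} dom yx (ab , bc , ca) (va , _ , bv) = xv , vy
        where
        xa = proj₁ (dom (inj₁ refl))
        xb = proj₁ (dom (inj₂ (inj₁ refl)))
        xc = proj₁ (dom (inj₂ (inj₂ refl)))
        ay = proj₂ (dom (inj₁ refl))
        by = proj₂ (dom (inj₂ (inj₁ refl)))
        cy = proj₂ (dom (inj₂ (inj₂ refl)))
        ρ = at a (b ∷ c ∷ x ∷ y ∷ v ∷ [])
        base : Facts ρ
        base = ((0 , 1) , ab) ∷ ((1 , 2) , bc) ∷ ((2 , 0) , ca)
             ∷ ((3 , 0) , xa) ∷ ((3 , 1) , xb) ∷ ((3 , 2) , xc)
             ∷ ((0 , 4) , ay) ∷ ((1 , 4) , by) ∷ ((2 , 4) , cy)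
             ∷ ((4 , 3) , yx) ∷ ((5 , 0) , va) ∷ ((1 , 5) , bv) ∷ []
        xv : x ⇒ v
        xv with compare x v
        ... | same refl = ⊥-elim (asym xb bv)
        ... | fwd e     = e
        ... | bwd vx    = ⊥-elim (by-search 6 ρ (noU5 ∷ []) (((5 , 3) , vx) ∷ base) ((5 , 2) ∷ (5 , 4) ∷ []) refl)
        vy : v ⇒ y
        vy with compare v y
        ... | same refl = ⊥-elim (asym va ay)
        ... | fwd e     = e
        ... | bwd yv    = ⊥-elim (by-search 6 ρ (noU5 ∷ []) (((4 , 5) , yv) ∷ base) ((5 , 2) ∷ (5 , 3) ∷ []) refl)

    prime⇒noD5 : ¬ Hom D5 G
    prime⇒noD5 (f , fE) =
      let S , all , inv = triangle-ind prime Inv grow {f 0F} {f 1F} {f 2F} (fE refl , fE refl , fE refl) inv₀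
      -- `S` is now the whole vertex set, so x lies in it and would dominate itself.
      in irr (proj₁ (inv (all x)))
      where
      x = f 3F
      y = f 4F
      Inv : Subset (n G) → Set
      Inv S = ∀ {s} → s ∈ S → x ⇒ s × s ⇒ y
      inv₀ : Inv (triangle-set (f 0F) (f 1F) (f 2F))
      inv₀ s∈ with ∈triangle-set s∈
      ... | inj₁ refl        = fE refl , fE refl
      ... | inj₂ (inj₁ refl) = fE refl , fE refl
      ... | inj₂ (inj₂ refl) = fE refl , fE refl
      grow : ∀ {S v} → Strong S → Mixed S v → Inv S → Inv (insert v S)
      grow {S} {v} str m inv s∈ with ∈insert s∈
      ... | old s∈S = inv s∈S
      ... | new =
        let a , b , c , (a∈ , b∈ , c∈) , abc , vab = crossing-triangle str m
        in dominated-extends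
             (λ { (inj₁ refl) → inv a∈ ; (inj₂ (inj₁ refl)) → inv b∈ ; (inj₂ (inj₂ refl)) → inv c∈ })
             (fE refl) abc vab

-- Extending 3-colourings

third-unique : ∀ (p q x y : Fin 3) → p ≢ q → x ≢ p → x ≢ q → y ≢ p → y ≢ q → x ≡ y
third-unique = toWitness {a? = all? λ p → all? λ q → all? λ x → all? λ y →
  ¬? (p Fin.≟ q) →-dec ¬? (x Fin.≟ p) →-dec ¬? (x Fin.≟ q) →-dec
  ¬? (y Fin.≟ p) →-dec ¬? (y Fin.≟ q) →-dec (x Fin.≟ y)} _

third : ∀ (p q : Fin 3) → ∃ λ x → x ≢ p × x ≢ q
third = toWitness {a? = all? λ p → all? λ q → any? λ x → ¬? (x Fin.≟ p) ×-dec ¬? (x Fin.≟ q)} _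

IsRainbow : ∀ {A : Set} → (A → Fin 3) → A → A → A → Set
IsRainbow c x y z = c x ≢ c y × c y ≢ c z × c z ≢ c x

rainbow-twins : ∀ {A : Set} (c : A → Fin 3) {a b x y} → IsRainbow c a b x → IsRainbow c a b y → c x ≡ c y
rainbow-twins c {a} {b} {x} {y} (ab , bx , xa) (_ , by , ya) =
  third-unique (c a) (c b) (c x) (c y) ab xa (bx ∘ sym) ya (by ∘ sym)

module Colouring (G : Digraph) (tour : IsTournament G) where
  open Tournament G tour

  -- All cyclic triangles use three colours exactly when the union of any two colour classes is
  -- transitive. On the whole vertex set such a colouring is therefore the partition X, Y, Z.
  Proper : (V → Fin 3) → Subset (n G) → Set
  Proper c S = ∀ {x y z} → x ∈ S → y ∈ S → z ∈ S → Cyc x y z → IsRainbow c x y z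

  module _ (free : All (λ H → ¬ Hom H G) (U5 ∷ T 2 ∷ D5 ∷ []))
    {S : Subset (n G)} {c : V → Fin 3} (proper : Proper c S) {v : V} (v∉S : v ∉ S) where

    private module _ {a : V} (a∈ : a ∈ S) (va : v ⇒ a) where

      record Head (b : V) : Set where
        constructor head
        field
          ∈S  : b ∈ S
          a⇒b : a ⇒ b
          b⇒v : b ⇒ v

      -- The induction is on the length of a path from the dominated head p₀ back to the common tail
      -- a, so that every shortcut of the path yields an earlier instance.
      HeadsAgree : ℕ → Set
      HeadsAgree m = ∀ {b p₀} → Head b → Head p₀ → b ⇒ p₀ → Path S m p₀ a → c b ≡ c p₀

      module _ {m : ℕ} (ih : ∀ {k} → k < suc (suc m) → HeadsAgree k)
        {b p₀ p₁ p₂ : V} (hb : Head b) (h₀ : Head p₀) (bp₀ : b ⇒ p₀)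
        (p₁∈ : p₁ ∈ S) (p₂∈ : p₂ ∈ S) (p₀p₁ : p₀ ⇒ p₁) (p₁p₂ : p₁ ⇒ p₂) where

        open Head hb renaming (∈S to b∈; a⇒b to ab; b⇒v to bv)
        open Head h₀ renaming (∈S to p₀∈; a⇒b to ap₀; b⇒v to p₀v)

        -- Shortcuts of the path p₀ ⇒ p₁ ⇒ p₂ ⇒ p₃ ⇒ … to a are left to the induction hypothesis;
        -- without them p₃ is again a head, of the same colour as p₀.
        module _ (p₂p₀ : p₂ ⇒ p₀) (ap₁ : a ⇒ p₁) (vp₁ : v ⇒ p₁) where

          ρ₅ = at v (a ∷ p₀ ∷ p₁ ∷ p₂ ∷ [])
          facts₅ : Facts ρ₅
          facts₅ = ((0 , 1) , va) ∷ ((1 , 2) , ap₀) ∷ ((2 , 0) , p₀v) ∷ ((2 , 3) , p₀p₁)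
                 ∷ ((3 , 4) , p₁p₂) ∷ ((4 , 2) , p₂p₀) ∷ ((1 , 3) , ap₁) ∷ ((0 , 3) , vp₁) ∷ []

          ap₂ : a ⇒ p₂
          ap₂ with compare a p₂
          ... | fwd e     = e
          ... | same refl = ⊥-elim (asym ap₁ p₁p₂)
          ... | bwd p₂a   = ⊥-elim (by-search 5 ρ₅ free (((4 , 1) , p₂a) ∷ facts₅) ((0 , 4) ∷ []) refl)

          vp₂ : v ⇒ p₂
          vp₂ with compare v p₂
          ... | fwd e     = e
          ... | same refl = ⊥-elim (v∉S p₂∈)
          ... | bwd p₂v   = ⊥-elim (by-search 5 ρ₅ free (((4 , 0) , p₂v) ∷ ((1 , 4) , ap₂) ∷ facts₅) [] refl)

          module _ {p₃ : V} (p₃∈ : p₃ ∈ S) (p₂p₃ : p₂ ⇒ p₃) (p₃p₀ : p₃ ⇒ p₀) (p₃p₁ : p₃ ⇒ p₁) where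

            ρ₆ = at v (a ∷ p₀ ∷ p₁ ∷ p₂ ∷ p₃ ∷ b ∷ [])
            facts₆ : Facts ρ₆
            facts₆ = ((0 , 1) , va) ∷ ((1 , 2) , ap₀) ∷ ((2 , 0) , p₀v) ∷ ((2 , 3) , p₀p₁)
                   ∷ ((3 , 4) , p₁p₂) ∷ ((4 , 2) , p₂p₀) ∷ ((1 , 3) , ap₁) ∷ ((0 , 3) , vp₁)
                   ∷ ((1 , 4) , ap₂) ∷ ((0 , 4) , vp₂)
                   ∷ ((4 , 5) , p₂p₃) ∷ ((5 , 2) , p₃p₀) ∷ ((5 , 3) , p₃p₁) ∷ []

            p₃v : p₃ ⇒ v
            p₃v with compare v p₃
            ... | bwd e     = e
            ... | same refl = ⊥-elim (v∉S p₃∈)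
            ... | fwd vp₃   = ⊥-elim (by-search 6 ρ₆ free (((0 , 5) , vp₃) ∷ facts₆) [] refl)

            ap₃ : a ⇒ p₃
            ap₃ with compare a p₃
            ... | fwd e     = e
            ... | same refl = ⊥-elim (asym ap₂ p₂p₃)
            ... | bwd p₃a   = ⊥-elim (by-search 6 ρ₆ free (((5 , 1) , p₃a) ∷ ((5 , 0) , p₃v) ∷ facts₆) [] refl)

            p₀~p₃ : c p₀ ≡ c p₃
            p₀~p₃ = rainbow-twins c (proper p₁∈ p₂∈ p₀∈ (p₁p₂ , p₂p₀ , p₀p₁))
                                    (proper p₁∈ p₂∈ p₃∈ (p₁p₂ , p₂p₃ , p₃p₁))

            -- With p₃ ⇒ b, the excluded tournaments force b to be joined to p₁ and p₂ as p₀ is;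
            -- then b and p₀ both complete the edge p₁ ⇒ p₂ to a triangle.
            turn-back : p₃ ⇒ b → c b ≡ c p₀
            turn-back p₃b = rainbow-twins c (proper p₁∈ p₂∈ b∈ (p₁p₂ , p₂b , bp₁))
                                            (proper p₁∈ p₂∈ p₀∈ (p₁p₂ , p₂p₀ , p₀p₁))
              where
              facts₇ : Facts ρ₆
              facts₇ = ((5 , 0) , p₃v) ∷ ((1 , 5) , ap₃) ∷ ((1 , 6) , ab) ∷ ((6 , 0) , bv)
                     ∷ ((6 , 2) , bp₀) ∷ ((5 , 6) , p₃b) ∷ facts₆
              bp₁ : b ⇒ p₁
              bp₁ with compare b p₁
              ... | fwd e     = e
              ... | same refl = ⊥-elim (asym vp₁ bv)
              ... | bwd p₁b   = ⊥-elim (by-search 7 ρ₆ free (((3 , 6) , p₁b) ∷ facts₇) ((4 , 6) ∷ []) refl)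
              p₂b : p₂ ⇒ b
              p₂b with compare b p₂
              ... | bwd e     = e
              ... | same refl = ⊥-elim (asym vp₂ bv)
              ... | fwd bp₂   = ⊥-elim (by-search 7 ρ₆ free (((6 , 4) , bp₂) ∷ facts₇) ((3 , 6) ∷ []) refl)

            -- The head p₃ takes the place of p₀: it has the same colour and a shorter path to a.
            heads-agree₃ : ∀ {k} → k < m → Path S k p₃ a → c b ≡ c p₀
            heads-agree₃ k<m path with compare b p₃
            ... | same refl = sym p₀~p₃
            ... | fwd bp₃   = trans (ih (m<n⇒m<1+n (m<n⇒m<1+n k<m)) hb (head p₃∈ ap₃ p₃v) bp₃ path) (sym p₀~p₃)
            ... | bwd p₃b   = turn-back p₃b

          heads-agree₂ : ∀ {k} → k ≤ m → Path S k p₂ a → c b ≡ c p₀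
          heads-agree₂ k≤m [] = ⊥-elim (irr ap₂)
          heads-agree₂ k≤m (_∷_ {y = p₃} (p₂p₃ , p₃∈) path) with compare p₃ p₀ | compare p₃ p₁
          ... | same refl | _         = ih (m<n⇒m<1+n (m<n⇒m<1+n k≤m)) hb h₀ bp₀ path
          ... | bwd p₀p₃  | _         = ih (m<n⇒m<1+n (s≤s k≤m)) hb h₀ bp₀ ((p₀p₃ , p₃∈) ∷ path)
          ... | fwd _     | same refl = ⊥-elim (asym p₁p₂ p₂p₃)
          ... | fwd _     | bwd p₁p₃  = ih (s≤s (s≤s k≤m)) hb h₀ bp₀ ((p₀p₁ , p₁∈) ∷ (p₁p₃ , p₃∈) ∷ path)
          ... | fwd p₃p₀  | fwd p₃p₁  = heads-agree₃ p₃∈ p₂p₃ p₃p₀ p₃p₁ k≤m path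

        heads-agree₁ : Path S m p₂ a → c b ≡ c p₀
        heads-agree₁ path with compare a p₁
        ... | same refl = ⊥-elim (asym ap₀ p₀p₁)
        ... | bwd p₁a with compare b p₁
        ...   | same refl = ⊥-elim (asym ab p₁a)
        -- The edge p₁ ⇒ a is completed to a triangle by b and by p₀.
        ...   | fwd bp₁   = rainbow-twins c (proper p₁∈ a∈ b∈ (p₁a , ab , bp₁)) (proper p₁∈ a∈ p₀∈ (p₁a , ap₀ , p₀p₁))
        ...   | bwd p₁b   = ⊥-elim (by-search 5 (at v (a ∷ p₀ ∷ p₁ ∷ b ∷ [])) free
                  ( ((0 , 1) , va) ∷ ((1 , 2) , ap₀) ∷ ((2 , 0) , p₀v) ∷ ((1 , 4) , ab) ∷ ((4 , 0) , bv)
                  ∷ ((4 , 2) , bp₀) ∷ ((2 , 3) , p₀p₁) ∷ ((3 , 1) , p₁a) ∷ ((3 , 4) , p₁b) ∷ [])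
                  ((0 , 3) ∷ []) refl)
        heads-agree₁ path | fwd ap₁ with compare p₀ p₂
        ... | same refl = ih (m<n⇒m<1+n ≤-refl) hb h₀ bp₀ path
        ... | fwd p₀p₂  = ih ≤-refl hb h₀ bp₀ ((p₀p₂ , p₂∈) ∷ path)
        ... | bwd p₂p₀ with compare v p₁
        ...   | same refl = ⊥-elim (v∉S p₁∈)
        -- Here p₁ would be a head too, and the induction hypothesis would give it the colour of p₀,
        -- although both lie in the triangle p₀, p₁, p₂.
        ...   | bwd p₁v   = ⊥-elim (proj₁ (proper p₀∈ p₁∈ p₂∈ (p₀p₁ , p₁p₂ , p₂p₀))
                  (ih ≤-refl h₀ (head p₁∈ ap₁ p₁v) p₀p₁ ((p₁p₂ , p₂∈) ∷ path)))
        ...   | fwd vp₁   = heads-agree₂ p₂p₀ ap₁ vp₁ ≤-refl path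

      heads-agree-step : ∀ m → (∀ {k} → k < m → HeadsAgree k) → HeadsAgree m
      heads-agree-step _ ih hb h₀ bp₀ []              = ⊥-elim (irr (Head.a⇒b h₀))
      heads-agree-step _ ih hb h₀ bp₀ ((p₀a , _) ∷ []) = ⊥-elim (asym (Head.a⇒b h₀) p₀a)
      heads-agree-step _ ih hb h₀ bp₀ ((p₀p₁ , p₁∈) ∷ (p₁p₂ , p₂∈) ∷ path) =
        heads-agree₁ ih hb h₀ bp₀ p₁∈ p₂∈ p₀p₁ p₁p₂ path

    heads-agree : Strong S → ∀ {a b b′} → a ∈ S → b ∈ S → b′ ∈ S → Cyc v a b → Cyc v a b′ → c b ≡ c b′
    heads-agree str {a} {b} {b′} a∈ b∈ b′∈ (va , ab , bv) (_ , ab′ , b′v) with compare b b′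
    ... | same refl = refl
    ... | fwd bb′ = <-rec (HeadsAgree a∈ va) (heads-agree-step a∈ va) _
                      (head b∈ ab bv) (head b′∈ ab′ b′v) bb′ (proj₂ (str b′∈ a∈))
    ... | bwd b′b = sym (<-rec (HeadsAgree a∈ va) (heads-agree-step a∈ va) _
                      (head b′∈ ab′ b′v) (head b∈ ab bv) b′b (proj₂ (str b∈ a∈)))

-- Reversing all edges, and extending a colouring by one vertex

rev-tournament : ∀ {G} → IsTournament G → IsTournament (Rev G)
rev-tournament (irr , total , asym) =
  irr , (λ u v u≢v → total v u (u≢v ∘ sym)) , (λ u v uv vu → asym v u uv vu)

-- An anti-automorphism `σ` of `H` turns copies in the reversed tournament into copies in `G`. U₅,
-- T₅ and D₅ all have one.
rev-hom : ∀ {H G} (σ : Fin (n H) → Fin (n H)) → (∀ i j → H ∶ i ⇒ j → H ∶ σ j ⇒ σ i) →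
  Hom H (Rev G) → Hom H G
rev-hom σ σ-rev (f , fE) = f ∘ σ , λ {i} {j} ij → fE (σ-rev i j ij)

reverses? : ∀ H (σ : Fin (n H) → Fin (n H)) → Dec (∀ i j → H ∶ i ⇒ j → H ∶ σ j ⇒ σ i)
reverses? H σ = all? λ i → all? λ j → (E H i j Bool.≟ true) →-dec (E H (σ j) (σ i) Bool.≟ true)

rev-noU5 : ∀ {G} → ¬ Hom U5 G → ¬ Hom U5 (Rev G)
rev-noU5 {G} = _∘ rev-hom {U5} {G} σ (toWitness {a? = reverses? U5 σ} _)
  where
  σ : Fin 5 → Fin 5
  σ 0F = 1F
  σ 1F = 0F
  σ 2F = 4F
  σ 3F = 3F
  σ 4F = 2F

rev-T5 : ∀ {G} → Hom (T 2) G → Hom (T 2) (Rev G)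
rev-T5 {G} = rev-hom {T 2} {Rev G} Fin.opposite (toWitness {a? = reverses? (T 2) Fin.opposite} _)

rev-noD5 : ∀ {G} → ¬ Hom D5 G → ¬ Hom D5 (Rev G)
rev-noD5 {G} = _∘ rev-hom {D5} {G} σ (toWitness {a? = reverses? D5 σ} _)
  where
  σ : Fin 5 → Fin 5
  σ 0F = 0F
  σ 1F = 2F
  σ 2F = 1F
  σ 3F = 4F
  σ 4F = 3F

module Extension (G : Digraph) (tour : IsTournament G)
  (noU5 : ¬ Hom U5 G) (noT5 : ¬ Hom (T 2) G) (noD5 : ¬ Hom D5 G) where
  open Tournament G tour
  open Colouring G tour
  private
    module Rᵗ = Tournament (Rev G) (rev-tournament {G} tour)
    module Rᶜ = Colouring (Rev G) (rev-tournament {G} tour)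

  free : All (λ H → ¬ Hom H G) (U5 ∷ T 2 ∷ D5 ∷ [])
  free = noU5 ∷ noT5 ∷ noD5 ∷ []

  rev-free : All (λ H → ¬ Hom H (Rev G)) (U5 ∷ T 2 ∷ D5 ∷ [])
  rev-free = rev-noU5 {G} noU5 ∷ noT5 ∘ rev-T5 {Rev G} ∷ rev-noD5 {G} noD5 ∷ []

  rev-path : ∀ {S m x y} → x ∈ S → Path S m x y → ∃ λ k → Rᵗ.Path S k y x
  rev-path x∈ [] = _ , Rᵗ.[]
  rev-path x∈ ((e , y∈) ∷ p) = _ , (proj₂ (rev-path y∈ p) Rᵗ.∷ʳ (e , x∈))

  rev-proper : ∀ {c S} → Proper c S → Rᶜ.Proper c S
  rev-proper proper x∈ y∈ z∈ (yx , zy , xz) =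
    let x≢z , z≢y , y≢x = proper x∈ z∈ y∈ (xz , zy , yx) in y≢x ∘ sym , z≢y ∘ sym , x≢z ∘ sym

  module _ {S : Subset (n G)} {c : V → Fin 3} (str : Strong S) (proper : Proper c S)
    {v : V} (v∉S : v ∉ S) where

    tails-agree : ∀ {a a′ b} → a ∈ S → a′ ∈ S → b ∈ S → Cyc v a b → Cyc v a′ b → c a ≡ c a′
    tails-agree a∈ a′∈ b∈ (va , ab , bv) (va′ , a′b , _) =
      Rᶜ.heads-agree rev-free (rev-proper {c} {S} proper) v∉S
        (λ x∈ y∈ → rev-path y∈ (proj₂ (str y∈ x∈))) b∈ a∈ a′∈ (bv , ab , va) (bv , a′b , va′)

    -- If a ⇒ b′, this edge crosses as well and shares its tail with a ⇒ b and its head with a′ ⇒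
    -- b′; likewise for a′ ⇒ b.
    edges-agree : ∀ {a b a′ b′} → a ∈ S → b ∈ S → a′ ∈ S → b′ ∈ S → Cyc v a b → Cyc v a′ b′ →
      c a ≡ c a′ × c b ≡ c b′
    edges-agree {a} {b} {a′} {b′} a∈ b∈ a′∈ b′∈ vab@(va , ab , bv) va′b′@(va′ , a′b′ , b′v)
      with compare a b′ | compare a′ b
    ... | same refl | _ = ⊥-elim (asym va b′v)
    ... | fwd ab′ | _ =
      let vab′ = va , ab′ , b′v in
      tails-agree a∈ a′∈ b′∈ vab′ va′b′ , heads-agree free proper v∉S str a∈ b∈ b′∈ vab vab′
    ... | bwd _ | same refl = ⊥-elim (asym va′ bv)
    ... | bwd _ | fwd a′b =
      let va′b = va′ , a′b , bv in
      tails-agree a∈ a′∈ b∈ vab va′b , heads-agree free proper v∉S str a′∈ b∈ b′∈ va′b va′b′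
    ... | bwd b′a | bwd ba′ = ⊥-elim (by-search 5 (at v (a ∷ b ∷ a′ ∷ b′ ∷ [])) free
            ( ((0 , 1) , va) ∷ ((1 , 2) , ab) ∷ ((2 , 0) , bv)
            ∷ ((0 , 3) , va′) ∷ ((3 , 4) , a′b′) ∷ ((4 , 0) , b′v)
            ∷ ((4 , 1) , b′a) ∷ ((2 , 3) , ba′) ∷ [] )
            ((1 , 3) ∷ (2 , 4) ∷ []) refl)

  rainbow-≡ : ∀ {c : V → Fin 3} x y z {i j k} → c x ≡ i → c y ≡ j → c z ≡ k →
    i ≢ j × j ≢ k × k ≢ i → IsRainbow c x y z
  rainbow-≡ x y z refl refl refl r = r

  proper-insert : ∀ {S v c γ} → v ∉ S → Proper c S →
    (∀ {x y} → x ∈ S → y ∈ S → Cyc v x y → γ ≢ c x × c x ≢ c y × c y ≢ γ) →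
    Proper (updateAt c v (λ _ → γ)) (insert v S)
  proper-insert {S} {v} {c} {γ} v∉S proper proper-v {x} {y} {z} x∈ y∈ z∈ cyc@(xy , yz , zx) =
    go (∈insert x∈) (∈insert y∈) (∈insert z∈) cyc
    where
    c′ = updateAt c v (λ _ → γ)

    c′-old : ∀ {x} → x ∈ S → c′ x ≡ c x
    c′-old {x} x∈ = updateAt-minimal x v c λ { refl → v∉S x∈ }

    rainbow-v : ∀ {x y} → x ∈ S → y ∈ S → Cyc v x y → IsRainbow c′ v x y
    rainbow-v {x} {y} x∈ y∈ vxy =
      rainbow-≡ {c′} v x y (updateAt-updates v c) (c′-old x∈) (c′-old y∈) (proper-v x∈ y∈ vxy)

    go : ∀ {x y z} → Insert v S x → Insert v S y → Insert v S z → Cyc x y z → IsRainbow c′ x y z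
    go {x} {y} {z} (old x∈) (old y∈) (old z∈) cyc =
      rainbow-≡ {c′} x y z (c′-old x∈) (c′-old y∈) (c′-old z∈) (proper x∈ y∈ z∈ cyc)
    go new      (old y∈) (old z∈) cyc = rainbow-v y∈ z∈ cyc
    go (old x∈) new      (old z∈) cyc = let p , q , r = rainbow-v z∈ x∈ (rotate cyc) in r , p , q
    go (old x∈) (old y∈) new      cyc = let p , q , r = rainbow-v x∈ y∈ (rotate (rotate cyc)) in q , r , p
    go new      new      _        (xy , _ , _) = ⊥-elim (irr xy)
    go new      (old _)  new      (_ , _ , zx) = ⊥-elim (irr zx)
    go (old _)  new      new      (_ , yz , _) = ⊥-elim (irr yz)

  -- All crossing edges carry the ordered colours of one of them, a ⇒ b, and these two colours
  -- differ since a ⇒ b lies in a triangle of `S`. The remaining colour is thus right for v in every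
  -- new triangle.
  extend : ∀ {S v} → Strong S → Mixed S v → (∃ λ c → Proper c S) → ∃ λ c → Proper c (insert v S)
  extend {S} {v} str m (c , proper) with crossing-triangle str m
  ... | a , b , d , (a∈ , b∈ , d∈) , abd , vab with third (c a) (c b)
  ...   | γ , γ≢a , γ≢b = updateAt c v (λ _ → γ) , proper-insert {c = c} v∉S proper λ x∈ y∈ vxy →
            let a~x , b~y = edges-agree str proper v∉S a∈ b∈ x∈ y∈ vab vxy
            in subst₂ (λ i j → γ ≢ i × i ≢ j × j ≢ γ) a~x b~y
                 (γ≢a , proj₁ (proper a∈ b∈ d∈ abd) , γ≢b ∘ sym)
    where v∉S = Mixed.v∉S m

  colourable : Prime G → ∀ {a b d} → Cyc a b d → ∃ λ c → ∀ {x y z} → Cyc x y z → IsRainbow c x y z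
  colourable prime {a} {b} {d} abd@(ab , bd , da) =
    let S , all , c , proper = triangle-ind prime (λ S → ∃ λ c → Proper c S) extend abd (c₀ , proper₀)
    in c , λ {x} {y} {z} → proper (all x) (all y) (all z)
    where
    -- The triangle a, b, d gets the colours 0, 1, 2; the colour 0 elsewhere is a placeholder,
    -- overwritten when a vertex is inserted.
    c₁ c₀ : V → Fin 3
    c₁ = updateAt (λ _ → 0F) b (λ _ → 1F)
    c₀ = updateAt c₁ d (λ _ → 2F)
    c₀a : c₀ a ≡ 0F
    c₀a = trans (updateAt-minimal a d c₁ λ { refl → irr da }) (updateAt-minimal a b (λ _ → 0F) λ { refl → irr ab })
    c₀b : c₀ b ≡ 1F
    c₀b = trans (updateAt-minimal b d c₁ λ { refl → irr bd }) (updateAt-updates b (λ _ → 0F))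
    c₀d : c₀ d ≡ 2F
    c₀d = updateAt-updates d c₁
    differ : ∀ {x y} → x ∈ triangle-set a b d → y ∈ triangle-set a b d → x ⇒ y → c₀ x ≢ c₀ y
    differ x∈ y∈ xy with ∈triangle-set x∈ | ∈triangle-set y∈
    ... | inj₁ refl        | inj₁ refl        = ⊥-elim (irr xy)
    ... | inj₂ (inj₁ refl) | inj₂ (inj₁ refl) = ⊥-elim (irr xy)
    ... | inj₂ (inj₂ refl) | inj₂ (inj₂ refl) = ⊥-elim (irr xy)
    ... | inj₁ refl        | inj₂ (inj₁ refl) = λ e → case trans (sym c₀a) (trans e c₀b) of λ ()
    ... | inj₁ refl        | inj₂ (inj₂ refl) = λ e → case trans (sym c₀a) (trans e c₀d) of λ ()
    ... | inj₂ (inj₁ refl) | inj₁ refl        = λ e → case trans (sym c₀b) (trans e c₀a) of λ ()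
    ... | inj₂ (inj₁ refl) | inj₂ (inj₂ refl) = λ e → case trans (sym c₀b) (trans e c₀d) of λ ()
    ... | inj₂ (inj₂ refl) | inj₁ refl        = λ e → case trans (sym c₀d) (trans e c₀a) of λ ()
    ... | inj₂ (inj₂ refl) | inj₂ (inj₁ refl) = λ e → case trans (sym c₀d) (trans e c₀b) of λ ()
    proper₀ : Proper c₀ (triangle-set a b d)
    proper₀ x∈ y∈ z∈ (xy , yz , zx) = differ x∈ y∈ xy , differ y∈ z∈ yz , differ z∈ x∈ zx

-- Prime tournaments that contain T₅

turn : Fin 5 → Fin 5 → Fin 5
turn r i = (toℕ i + toℕ r) mod 5

turn-hom : ∀ r i j → T 2 ∶ i ⇒ j → T 2 ∶ turn r i ⇒ turn r j
turn-hom = toWitness {a? = all? λ r → all? λ i → all? λ j →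
  (E (T 2) i j Bool.≟ true) →-dec (E (T 2) (turn r i) (turn r j) Bool.≟ true)} _

turn-zero : ∀ r → turn r 0F ≡ r
turn-zero = toWitness {a? = all? λ r → turn r 0F Fin.≟ r} _

turn-onto : ∀ r i → ∃ λ j → turn r j ≡ i
turn-onto = toWitness {a? = all? λ r → all? λ i → any? λ j → turn r j Fin.≟ i} _

T5-edge : ∀ i j → T 2 ∶ i ⇒ j → j ≡ turn 1F i ⊎ j ≡ turn 2F i
T5-edge = toWitness {a? = all? λ i → all? λ j →
  (E (T 2) i j Bool.≟ true) →-dec ((j Fin.≟ turn 1F i) ⊎-dec (j Fin.≟ turn 2F i))} _

mkT5 : ∀ G (f : Fin 5 → Fin (n G)) →
  (∀ i → G ∶ f i ⇒ f (turn 1F i) × G ∶ f i ⇒ f (turn 2F i)) → Hom (T 2) G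
mkT5 G f edges = f , λ {i} {j} ij → case T5-edge i j ij of λ where
  (inj₁ refl) → proj₁ (edges i)
  (inj₂ refl) → proj₂ (edges i)

module Circular (G : Digraph) (tour : IsTournament G)
  (free : All (λ H → ¬ Hom H G) (U5 ∷ D5 ∷ [])) where
  open Tournament G tour

  On : Hom (T 2) G → V → Set
  On f x = ∃ λ i → proj₁ f i ≡ x

  InT5 : V → V → V → Set
  InT5 x y z = ∃ λ f → On f x × On f y × On f z

  InT5-rotate : ∀ {x y z} → InT5 x y z → InT5 y z x
  InT5-rotate (f , x , y , z) = f , y , z , x

  -- T₅ is vertex-transitive.
  recentre : ∀ f {x} → On f x → ∃ λ g → proj₁ g 0F ≡ x × (∀ {y} → On f y → On g y) × (∀ i → On f (proj₁ g i))
  recentre (f , fE) (r , refl) =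
    (f ∘ turn r , λ {i} {j} ij → fE (turn-hom r i j ij)) , cong f (turn-zero r) ,
    (λ { (i , refl) → proj₁ (turn-onto r i) , cong f (proj₂ (turn-onto r i)) }) , λ i → turn r i , refl

  module _ (f : Fin 5 → V) (fE : ∀ {i j} → T 2 ∶ i ⇒ j → f i ⇒ f j) where
    private
      facts : ∀ {d} → Facts (at (f 0F) (f 1F ∷ f 2F ∷ f 3F ∷ f 4F ∷ d ∷ []))
      facts = ((0 , 1) , fE refl) ∷ ((0 , 2) , fE refl) ∷ ((1 , 2) , fE refl) ∷ ((1 , 3) , fE refl)
            ∷ ((2 , 3) , fE refl) ∷ ((2 , 4) , fE refl) ∷ ((3 , 4) , fE refl) ∷ ((3 , 0) , fE refl)
            ∷ ((4 , 0) , fE refl) ∷ ((4 , 1) , fE refl) ∷ []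

      contra : ∀ {d} → (fs : Facts (at (f 0F) (f 1F ∷ f 2F ∷ f 3F ∷ f 4F ∷ d ∷ []))) (ps : Edges) →
        refute (U5 ∷ D5 ∷ []) 6 (map proj₁ fs) ps ≡ true → ⊥
      contra {d} = by-search 6 (at (f 0F) (f 1F ∷ f 2F ∷ f 3F ∷ f 4F ∷ d ∷ [])) free

      replace₃ : ∀ {d} → f 1F ⇒ d → f 2F ⇒ d → d ⇒ f 4F → d ⇒ f 0F → Hom (T 2) G
      replace₃ {d} d₁ d₂ d₄ d₀ = mkT5 G (Vec.lookup (f 0F Vec.∷ f 1F Vec.∷ f 2F Vec.∷ d Vec.∷ f 4F Vec.∷ Vec.[])) λ where
        0F → fE refl , fE refl
        1F → fE refl , d₁
        2F → d₂ , fE refl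
        3F → d₄ , d₀
        4F → fE refl , fE refl

      replace₄ : ∀ {d} → f 2F ⇒ d → f 3F ⇒ d → d ⇒ f 0F → d ⇒ f 1F → Hom (T 2) G
      replace₄ {d} d₂ d₃ d₀ d₁ = mkT5 G (Vec.lookup (f 0F Vec.∷ f 1F Vec.∷ f 2F Vec.∷ f 3F Vec.∷ d Vec.∷ Vec.[])) λ where
        0F → fE refl , fE refl
        1F → fE refl , fE refl
        2F → fE refl , d₂
        3F → d₃ , fE refl
        4F → d₀ , d₁

    -- The new vertex d can take the place of `f 3F`, because the other directions of its edges to
    -- `f 2F` and `f 4F` lead to U₅ or D₅.
    edge₀₁ : ∀ {d} → f 1F ⇒ d → d ⇒ f 0F → InT5 (f 0F) (f 1F) d
    edge₀₁ {d} d₁ d₀ with compare (f 2F) d | compare d (f 4F)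
    ... | same refl | _         = ⊥-elim (asym d₀ (fE refl))
    ... | _         | same refl = ⊥-elim (asym d₁ (fE refl))
    ... | fwd d₂    | fwd d₄    = replace₃ d₁ d₂ d₄ d₀ , (0F , refl) , (1F , refl) , (3F , refl)
    ... | bwd d₂    | _         = ⊥-elim (contra
            (((5 , 2) , d₂) ∷ ((1 , 5) , d₁) ∷ ((5 , 0) , d₀) ∷ facts) ((3 , 5) ∷ (4 , 5) ∷ []) refl)
    ... | _         | bwd d₄    = ⊥-elim (contra
            (((4 , 5) , d₄) ∷ ((1 , 5) , d₁) ∷ ((5 , 0) , d₀) ∷ facts) ((3 , 5) ∷ (2 , 5) ∷ []) refl)

    -- In T₅ the edge from 0 to 2 is closed by 3 and by 4. If d is neither, the edge between d and
    -- `f 1F` decides which of them d replaces: 3 when `f 1F` ⇒ d, and 4 otherwise.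
    edge₀₂ : ∀ {d} → f 2F ⇒ d → d ⇒ f 0F → InT5 (f 0F) (f 2F) d
    edge₀₂ {d} d₂ d₀ with compare d (f 3F) | compare d (f 4F) | compare d (f 1F)
    ... | same refl | _         | _         = (f , fE) , (0F , refl) , (2F , refl) , (3F , refl)
    ... | _         | same refl | _         = (f , fE) , (0F , refl) , (2F , refl) , (4F , refl)
    ... | _         | _         | same refl = ⊥-elim (asym d₀ (fE refl))
    ... | _         | fwd d₄    | bwd d₁    = replace₃ d₁ d₂ d₄ d₀ , (0F , refl) , (2F , refl) , (3F , refl)
    ... | bwd d₃    | _         | fwd d₁    = replace₄ d₂ d₃ d₀ d₁ , (0F , refl) , (2F , refl) , (4F , refl)
    ... | _         | bwd d₄    | bwd d₁    = ⊥-elim (contra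
            (((4 , 5) , d₄) ∷ ((1 , 5) , d₁) ∷ ((2 , 5) , d₂) ∷ ((5 , 0) , d₀) ∷ facts) ((3 , 5) ∷ []) refl)
    ... | fwd d₃    | _         | fwd d₁    = ⊥-elim (contra
            (((5 , 3) , d₃) ∷ ((5 , 1) , d₁) ∷ ((2 , 5) , d₂) ∷ ((5 , 0) , d₀) ∷ facts) ((4 , 5) ∷ []) refl)

    -- The triangles of T₅ through 0 are 0 1 3, 0 2 3 and 0 2 4. An edge to w from one of the two
    -- remaining vertices would create a U₅ or D₅.
    dominates-T5 : ∀ {w j k} → Cyc (f 0F) (f j) (f k) → w ⇒ f 0F → w ⇒ f j → w ⇒ f k → ∀ l → w ⇒ f l
    dominates-T5 {w} = go
      where
      not-back : ∀ {l x} → w ⇒ x → x ⇒ f l → ¬ (f l ⇒ w) → w ⇒ f l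
      not-back {l} wx xl ¬lw with compare w (f l)
      ... | same refl = ⊥-elim (asym wx xl)
      ... | fwd wl    = wl
      ... | bwd lw    = ⊥-elim (¬lw lw)

      go : ∀ {j k} → Cyc (f 0F) (f j) (f k) → w ⇒ f 0F → w ⇒ f j → w ⇒ f k → ∀ l → w ⇒ f l
      go {0F}      (e , _ , _) _ _ _ _ = ⊥-elim (irr e)
      go {3F}      (e , _ , _) _ _ _ _ = ⊥-elim (asym e (fE refl))
      go {4F}      (e , _ , _) _ _ _ _ = ⊥-elim (asym e (fE refl))
      go {_} {0F}  (_ , _ , e) _ _ _ _ = ⊥-elim (irr e)
      go {_} {1F}  (_ , _ , e) _ _ _ _ = ⊥-elim (asym e (fE refl))
      go {_} {2F}  (_ , _ , e) _ _ _ _ = ⊥-elim (asym e (fE refl))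
      go {1F} {4F} (_ , e , _) _ _ _ _ = ⊥-elim (asym e (fE refl))
      go {1F} {3F} _ w₀ w₁ w₃ = λ where
        0F → w₀
        1F → w₁
        2F → not-back w₁ (fE refl) λ e → contra
               (((2 , 5) , e) ∷ ((5 , 0) , w₀) ∷ ((5 , 1) , w₁) ∷ ((5 , 3) , w₃) ∷ facts) ((4 , 5) ∷ []) refl
        3F → w₃
        4F → not-back w₃ (fE refl) λ e → contra
               (((4 , 5) , e) ∷ ((5 , 0) , w₀) ∷ ((5 , 1) , w₁) ∷ ((5 , 3) , w₃) ∷ facts) ((2 , 5) ∷ []) refl
      go {2F} {3F} _ w₀ w₂ w₃ = λ where
        0F → w₀
        1F → not-back w₀ (fE refl) λ e → contra
               (((1 , 5) , e) ∷ ((5 , 0) , w₀) ∷ ((5 , 2) , w₂) ∷ ((5 , 3) , w₃) ∷ facts) ((4 , 5) ∷ []) refl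
        2F → w₂
        3F → w₃
        4F → not-back w₂ (fE refl) λ e → contra
               (((4 , 5) , e) ∷ ((5 , 0) , w₀) ∷ ((5 , 2) , w₂) ∷ ((5 , 3) , w₃) ∷ facts) ((1 , 5) ∷ []) refl
      go {2F} {4F} _ w₀ w₂ w₄ = λ where
        0F → w₀
        1F → not-back w₀ (fE refl) λ e → contra
               (((1 , 5) , e) ∷ ((5 , 0) , w₀) ∷ ((5 , 2) , w₂) ∷ ((5 , 4) , w₄) ∷ facts) ((3 , 5) ∷ []) refl
        2F → w₂
        3F → not-back w₂ (fE refl) λ e → contra
               (((3 , 5) , e) ∷ ((5 , 0) , w₀) ∷ ((5 , 2) , w₂) ∷ ((5 , 4) , w₄) ∷ facts) ((1 , 5) ∷ []) refl
        4F → w₄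

    domination-extends : ∀ {w v j} → (∀ l → w ⇒ f l) → Cyc v (f 0F) (f j) → w ⇒ v
    domination-extends {w} {v} {j} w⇒ (v₀ , e , jv) with compare w v
    ... | same refl = ⊥-elim (asym (w⇒ j) jv)
    ... | fwd wv    = wv
    ... | bwd vw    = ⊥-elim (go j e jv)
      where
      base : Facts (at (f 0F) (f 1F ∷ f 2F ∷ f 3F ∷ f 4F ∷ w ∷ v ∷ []))
      base = ((5 , 0) , w⇒ 0F) ∷ ((5 , 1) , w⇒ 1F) ∷ ((5 , 2) , w⇒ 2F) ∷ ((5 , 3) , w⇒ 3F) ∷ ((5 , 4) , w⇒ 4F)
           ∷ ((6 , 5) , vw) ∷ ((6 , 0) , v₀)
           ∷ ((0 , 1) , fE refl) ∷ ((0 , 2) , fE refl) ∷ ((1 , 2) , fE refl) ∷ ((1 , 3) , fE refl)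
           ∷ ((2 , 3) , fE refl) ∷ ((2 , 4) , fE refl) ∷ ((3 , 4) , fE refl) ∷ ((3 , 0) , fE refl)
           ∷ ((4 , 0) , fE refl) ∷ ((4 , 1) , fE refl) ∷ []
      go : ∀ j → f 0F ⇒ f j → f j ⇒ v → ⊥
      go 0F e _ = irr e
      go 3F e _ = asym e (fE refl)
      go 4F e _ = asym e (fE refl)
      go 1F _ jv = by-search 7 _ free (((1 , 6) , jv) ∷ base) ((2 , 6) ∷ (4 , 6) ∷ []) refl
      go 2F _ jv = by-search 7 _ free (((2 , 6) , jv) ∷ base) ((1 , 6) ∷ (4 , 6) ∷ (3 , 6) ∷ []) refl

  -- After rotating x to position 0, the vertex y is at position 1 or 2.
  share-edge : ∀ {x y d} f → On f x → On f y → Cyc x y d → InT5 x y d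
  share-edge f x∈ y∈ (xy , yd , dx) with recentre f x∈
  ... | (g , gE) , refl , onto , _ with onto y∈
  ...   | 0F , refl = ⊥-elim (irr xy)
  ...   | 1F , refl = edge₀₁ g gE yd dx
  ...   | 2F , refl = edge₀₂ g gE yd dx
  ...   | 3F , refl = ⊥-elim (asym xy (gE refl))
  ...   | 4F , refl = ⊥-elim (asym xy (gE refl))

  -- An intermediate triangle shares an edge with each of the two: w a d if a ⇒ d, and b w c if c ⇒
  -- b. If d ⇒ a and b ⇒ c, the five vertices contain a U₅ or D₅.
  share-vertex : ∀ {w a b c d} → Cyc w a b → InT5 w a b → Cyc w c d → InT5 w c d
  share-vertex {w} {a} {b} {c} {d} (wa , ab , bw) (f , w∈ , a∈ , b∈) (wc , cd , dw) with compare a d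
  ... | same refl = ⊥-elim (asym wa dw)
  ... | fwd ad with share-edge f w∈ a∈ (wa , ad , dw)
  ...   | g , w∈g , a∈g , d∈g = InT5-rotate (share-edge g d∈g w∈g (dw , wc , cd))
  share-vertex {w} {a} {b} {c} {d} (wa , ab , bw) (f , w∈ , a∈ , b∈) (wc , cd , dw) | bwd da with compare b c
  ... | same refl = ⊥-elim (asym wc bw)
  ... | bwd cb with share-edge f b∈ w∈ (bw , wc , cb)
  ...   | g , b∈g , w∈g , c∈g = share-edge g w∈g c∈g (wc , cd , dw)
  share-vertex {w} {a} {b} {c} {d} (wa , ab , bw) _ (wc , cd , dw) | bwd da | fwd bc =
    ⊥-elim (by-search 5 (at w (a ∷ b ∷ c ∷ d ∷ [])) free
      ( ((0 , 1) , wa) ∷ ((1 , 2) , ab) ∷ ((2 , 0) , bw) ∷ ((0 , 3) , wc) ∷ ((3 , 4) , cd)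
      ∷ ((4 , 0) , dw) ∷ ((4 , 1) , da) ∷ ((2 , 3) , bc) ∷ []) ((1 , 3) ∷ (2 , 4) ∷ []) refl)

  dominates-InT5 : ∀ {w x y z} → Cyc x y z → w ⇒ x → w ⇒ y → w ⇒ z → (t : InT5 x y z) →
    ∀ {u} → On (proj₁ t) u → w ⇒ u
  dominates-InT5 xyz wx wy wz (f , x∈ , y∈ , z∈) u∈ with recentre f x∈
  ... | (g , gE) , refl , onto , _ with onto y∈ | onto z∈ | onto u∈
  ...   | j , refl | k , refl | l , refl = dominates-T5 g gE xyz wx wy wz l

  dominates-crossing : ∀ {w v x y} f → (∀ {u} → On f u → w ⇒ u) → On f x → On f y → Cyc v x y → w ⇒ v
  dominates-crossing f w⇒ x∈ y∈ vxy with recentre f x∈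
  ... | (g , gE) , refl , onto , on-f with onto y∈
  ...   | j , refl = domination-extends g gE (λ l → w⇒ (on-f l)) vxy

  module _ (prime : Prime G) (T5⊂G : Hom (T 2) G) where
    private
      f = proj₁ T5⊂G
      fE : ∀ {i j} → T 2 ∶ i ⇒ j → f i ⇒ f j
      fE = proj₂ T5⊂G

    -- For an added vertex v, a triangle a b c of `S` with v a b cyclic lies in a T₅. Sharing the
    -- edge a ⇒ b puts v a b in a T₅, and sharing v does so for all other triangles through v.
    triangle-InT5 : ∀ {x y z} → Cyc x y z → InT5 x y z
    triangle-InT5 {x} {y} {z} =
      let S , all , inv = triangle-ind prime Inv grow {f 0F} {f 1F} {f 3F} (fE refl , fE refl , fE refl)
            λ x∈ y∈ z∈ _ →
            T5⊂G , on (∈triangle-set x∈) , on (∈triangle-set y∈) , on (∈triangle-set z∈)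
      in inv (all x) (all y) (all z)
      where
      on : ∀ {x} → x ≡ f 0F ⊎ x ≡ f 1F ⊎ x ≡ f 3F → On T5⊂G x
      on (inj₁ refl)        = 0F , refl
      on (inj₂ (inj₁ refl)) = 1F , refl
      on (inj₂ (inj₂ refl)) = 3F , refl

      Inv : Subset (n G) → Set
      Inv S = ∀ {x y z} → x ∈ S → y ∈ S → z ∈ S → Cyc x y z → InT5 x y z

      grow : ∀ {S v} → Strong S → Mixed S v → Inv S → Inv (insert v S)
      grow {S} {v} str m inv {x} {y} {z} x∈ y∈ z∈ xyz with crossing-triangle str m
      ... | a , b , c , (a∈ , b∈ , c∈) , abc , vab with inv a∈ b∈ c∈ abc
      ...   | g , a∈g , b∈g , _ = go (∈insert x∈) (∈insert y∈) (∈insert z∈) xyz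
        where
        through-v : ∀ {x y} → Cyc v x y → InT5 v x y
        through-v = share-vertex vab (InT5-rotate (InT5-rotate (share-edge g a∈g b∈g (rotate vab))))
        go : ∀ {x y z} → Insert v S x → Insert v S y → Insert v S z → Cyc x y z → InT5 x y z
        go (old x∈) (old y∈) (old z∈) xyz = inv x∈ y∈ z∈ xyz
        go new      _        _        xyz = through-v xyz
        go _        new      _        xyz = InT5-rotate (InT5-rotate (through-v (rotate xyz)))
        go _        _        new      xyz = InT5-rotate (through-v (rotate (rotate xyz)))

    -- Domination by w spreads from `S` to each added vertex through a T₅ that contains a crossed
    -- triangle of `S`; in the end w would dominate itself.
    no-dominated-triangle : ∀ {w a b c} → Cyc a b c → w ⇒ a → w ⇒ b → w ⇒ c → ⊥
    no-dominated-triangle {w} abc wa wb wc =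
      let S , all , inv = triangle-ind prime Inv grow abc λ s∈ → case ∈triangle-set s∈ of λ where
            (inj₁ refl)        → wa
            (inj₂ (inj₁ refl)) → wb
            (inj₂ (inj₂ refl)) → wc
      in irr (inv (all w))
      where
      Inv : Subset (n G) → Set
      Inv S = ∀ {s} → s ∈ S → w ⇒ s
      grow : ∀ {S v} → Strong S → Mixed S v → Inv S → Inv (insert v S)
      grow {S} {v} str m inv s∈ with ∈insert s∈ | crossing-triangle str m
      ... | old s∈S | _ = inv s∈S
      ... | new | a , b , c , (a∈ , b∈ , c∈) , abc , vab with triangle-InT5 abc
      ...   | t@(g , a∈g , b∈g , _) =
        dominates-crossing g (dominates-InT5 abc (inv a∈) (inv b∈) (inv c∈) t) a∈g b∈g vab

-- The tournaments T_n

-- A missed value could be added to f, giving an injection from a set of m + 1 elements into one of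
-- k ≤ m.
injective⇒surjective : ∀ {m k} (f : Fin m → Fin k) → Injective _≡_ _≡_ f → k ≤ m → ∀ y → ∃ λ x → f x ≡ y
injective⇒surjective {m} {k} f inj k≤m y with any? (λ x → f x Fin.≟ y)
... | yes hit = hit
... | no miss = ⊥-elim (<-irrefl refl (≤-trans (injective⇒≤ {f = g} g-inj) k≤m))
  where
  g : Fin (suc m) → Fin k
  g zero    = y
  g (suc x) = f x
  g-inj : Injective _≡_ _≡_ g
  g-inj {zero}  {zero}  _  = refl
  g-inj {zero}  {suc x} eq = ⊥-elim (miss (x , sym eq))
  g-inj {suc x} {zero}  eq = ⊥-elim (miss (x , eq))
  g-inj {suc x} {suc z} eq = cong suc (inj eq)

-- Distinct vertices of `H` are joined by an edge, whose image is an edge and not a loop; asymmetry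
-- of `G` then makes f reflect edges.
hom-embeds : ∀ {H G} → IsTournament H → (∀ u v → G ∶ u ⇒ v → ¬ (G ∶ v ⇒ u)) → (h : Hom H G) →
  Injective _≡_ _≡_ (proj₁ h) × (∀ a b → E H a b ≡ E G (proj₁ h a) (proj₁ h b))
hom-embeds {H} {G} tour asymG (f , fE) = inj , edges
  where
  open Tournament H tour
  loopless : ∀ {u} → ¬ (G ∶ u ⇒ u)
  loopless uu = asymG _ _ uu uu
  inj : Injective _≡_ _≡_ f
  inj {a} {b} fa≡fb with compare a b
  ... | same eq = eq
  ... | fwd ab  = ⊥-elim (loopless (subst (λ y → G ∶ f a ⇒ y) (sym fa≡fb) (fE ab)))
  ... | bwd ba  = ⊥-elim (loopless (subst (λ y → G ∶ f b ⇒ y) fa≡fb (fE ba)))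
  edges : ∀ a b → E H a b ≡ E G (f a) (f b)
  edges a b with compare a b
  ... | same refl = trans (¬-not irr) (sym (¬-not loopless))
  ... | fwd ab    = trans ab (sym (fE ab))
  ... | bwd ba    = trans (¬-not (asym ba)) (sym (¬-not (asymG _ _ (fE ba))))

U5-tournament : IsTournament U5
U5-tournament =
  toWitness {a? = all? λ u → ¬? (E U5 u u Bool.≟ true)} _ ,
  toWitness {a? = all? λ u → all? λ v → ¬? (u Fin.≟ v) →-dec
    ((E U5 u v Bool.≟ true) ⊎-dec (E U5 v u Bool.≟ true))} _ ,
  toWitness {a? = all? λ u → all? λ v → (E U5 u v Bool.≟ true) →-dec ¬? (E U5 v u Bool.≟ true)} _

hom⇒contains : ∀ {G} → IsTournament G → Hom U5 G → Contains G U5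
hom⇒contains {G} tour h = proj₁ h , hom-embeds {U5} {G} U5-tournament (proj₂ (proj₂ tour)) h

contains⇒hom : ∀ {G H} → Contains G H → Hom H G
contains⇒hom (f , _ , fE) = f , λ {i} {j} ij → trans (sym (fE i j)) ij

-- Edges of T_n and its transitive out-neighbourhoods

module Rotational (k : ℕ) where

  infix 4 _↷_
  -- The edge relation of T_n on 0, ..., 2k without modular arithmetic: a forward step of at most k,
  -- or a backward step of more than k.
  _↷_ : ℕ → ℕ → Set
  i ↷ j = (i < j × j ≤ i + k) ⊎ j + k < i

  distance : ℕ → ℕ → ℕ
  distance i j = (j + suc (k + k) ∸ i) % suc (k + k)

  distance-fwd : ∀ i d → d < suc (k + k) → distance i (i + d) ≡ d
  distance-fwd i d d<n = begin
    (i + d + suc (k + k) ∸ i) % suc (k + k)   ≡⟨ cong (λ m → (m ∸ i) % suc (k + k)) (+-assoc i d _) ⟩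
    (i + (d + suc (k + k)) ∸ i) % suc (k + k) ≡⟨ cong (_% suc (k + k)) (m+n∸m≡n i _) ⟩
    (d + suc (k + k)) % suc (k + k)           ≡⟨ [m+n]%n≡m%n d (suc (k + k)) ⟩
    d % suc (k + k)                           ≡⟨ m<n⇒m%n≡m d<n ⟩
    d                                         ∎
    where open ≡-Reasoning

  distance-bwd : ∀ j e → distance (j + suc e) j ≡ k + k ∸ e
  distance-bwd j e = trans (cong (_% suc (k + k)) ([m+n]∸[m+o]≡n∸o j (suc (k + k)) (suc e)))
    (m<n⇒m%n≡m (s≤s (m∸n≤m (k + k) e)))

  short : ∀ {d} → 1 ≤ d → d ≤ k → (1 ≤ᵇ d) ∧ (d ≤ᵇ k) ≡ true
  short p q = cong₂ _∧_ (Equivalence.to T-≡ (≤⇒≤ᵇ p)) (Equivalence.to T-≡ (≤⇒≤ᵇ q))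

  short⁻¹ : ∀ d → (1 ≤ᵇ d) ∧ (d ≤ᵇ k) ≡ true → 1 ≤ d × d ≤ k
  short⁻¹ d eq = let p , q = ∧-elim {1 ≤ᵇ d} eq in
    ≤ᵇ⇒≤ 1 d (Equivalence.from T-≡ p) , ≤ᵇ⇒≤ d k (Equivalence.from T-≡ q)

  ↷⇒edge : ∀ {i j : Fin (suc (k + k))} → toℕ i ↷ toℕ j → T k ∶ i ⇒ j
  ↷⇒edge {i} {j} = go (toℕ<n i) (toℕ<n j)
    where
    go : ∀ {i j} → i < suc (k + k) → j < suc (k + k) → i ↷ j → (1 ≤ᵇ distance i j) ∧ (distance i j ≤ᵇ k) ≡ true
    go {i} {j} _ _ (inj₁ (i<j , j≤i+k)) with m≤n⇒∃[o]m+o≡n (<⇒≤ i<j)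
    ... | d , refl rewrite distance-fwd i d (s≤s (≤-trans (+-cancelˡ-≤ i d k j≤i+k) (m≤m+n k k))) =
      short (+-cancelˡ-≤ i 1 d (subst (_≤ i + d) (sym (+-comm i 1)) i<j)) (+-cancelˡ-≤ i d k j≤i+k)
    go {i} {j} i<n _ (inj₂ j+k<i) with m≤n⇒∃[o]m+o≡n (≤-trans (s≤s (m≤m+n j k)) j+k<i)
    ... | e , refl rewrite sym (+-suc j e) | distance-bwd j e =
      short (m<n⇒0<n∸m e<2k) (≤-trans (∸-monoʳ-≤ (k + k) k≤e) (≤-reflexive (m+n∸m≡n k k)))
      where
      k≤e : k ≤ e
      k≤e = ≤-pred (+-cancelˡ-≤ j (suc k) (suc e) (≤-trans (≤-reflexive (+-suc j k)) j+k<i))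
      e<2k : e < k + k
      e<2k = ≤-trans (m≤n+m (suc e) j) (≤-pred i<n)

  edge⇒↷ : ∀ {i j : Fin (suc (k + k))} → T k ∶ i ⇒ j → toℕ i ↷ toℕ j
  edge⇒↷ {i} {j} = go (toℕ<n i) (toℕ<n j)
    where
    go : ∀ {i j} → i < suc (k + k) → j < suc (k + k) → (1 ≤ᵇ distance i j) ∧ (distance i j ≤ᵇ k) ≡ true → i ↷ j
    go {i} {j} i<n j<n e with i ≤? j
    ... | yes i≤j with m≤n⇒∃[o]m+o≡n i≤j
    ...   | d , refl with short⁻¹ d (subst (λ m → (1 ≤ᵇ m) ∧ (m ≤ᵇ k) ≡ true)
                           (distance-fwd i d (≤-<-trans (m≤n+m d i) j<n)) e)
    ...     | p , q = inj₁ (subst (_≤ i + d) (+-comm i 1) (+-monoʳ-≤ i p) , +-monoʳ-≤ i q)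
    go {i} {j} i<n j<n e | no i≰j with m≤n⇒∃[o]m+o≡n (≰⇒> i≰j)
    ... | e′ , refl with short⁻¹ (k + k ∸ e′) (subst (λ m → (1 ≤ᵇ m) ∧ (m ≤ᵇ k) ≡ true)
                           (trans (cong (λ m → distance m j) (sym (+-suc j e′))) (distance-bwd j e′)) e)
    ...   | _ , q = inj₂ (s≤s (+-monoʳ-≤ j k≤e))
      where
      k≤e : k ≤ e′
      k≤e = +-cancelˡ-≤ k k e′ (≤-trans (m≤n+m∸n (k + k) e′) (≤-trans (+-monoʳ-≤ e′ q) (≤-reflexive (+-comm e′ k))))

  ↷-asym : ∀ {i j} → i ↷ j → ¬ (j ↷ i)
  ↷-asym (inj₁ (i<j , _))     (inj₁ (j<i , _))     = <-asym i<j j<i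
  ↷-asym (inj₁ (_ , j≤i+k))   (inj₂ i+k<j)         = <⇒≱ i+k<j j≤i+k
  ↷-asym (inj₂ j+k<i)         (inj₁ (_ , i≤j+k))   = <⇒≱ j+k<i i≤j+k
  ↷-asym {i} {j} (inj₂ j+k<i) (inj₂ i+k<j)         = <-asym (m+n≤o⇒m≤o (suc j) j+k<i) (m+n≤o⇒m≤o (suc i) i+k<j)

  edge-asym : ∀ i j → T k ∶ i ⇒ j → ¬ (T k ∶ j ⇒ i)
  edge-asym i j ij ji = ↷-asym (edge⇒↷ {i} {j} ij) (edge⇒↷ {j} {i} ji)

  -- The position of x after v when the circle is cut open at v.
  unroll : ∀ {v x} → v ↷ x → ℕ
  unroll {x = x} (inj₁ _) = x
  unroll {x = x} (inj₂ _) = x + suc (k + k)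

  -- The out-neighbours of v lie on an arc of k consecutive places, inside which all edges point
  -- forward.
  unroll-mono : ∀ {v x y} → v < suc (k + k) → x < suc (k + k) →
    (p : v ↷ x) (q : v ↷ y) → x ↷ y → unroll p < unroll q
  unroll-mono _ _ (inj₁ _) (inj₁ _) (inj₁ (x<y , _)) = x<y
  unroll-mono {v} _ _ (inj₁ (_ , x≤v+k)) (inj₁ (v<y , _)) (inj₂ y+k<x) =
    ⊥-elim (<⇒≱ (≤-trans y+k<x x≤v+k) (+-monoˡ-≤ k (<⇒≤ v<y)))
  unroll-mono {y = y} _ x<n (inj₁ _) (inj₂ _) _ = ≤-trans x<n (m≤n+m _ y)
  unroll-mono _ _ (inj₂ x+k<v) (inj₁ (v<y , _)) (inj₁ (_ , y≤x+k)) = ⊥-elim (<⇒≱ (<-trans x+k<v v<y) y≤x+k)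
  unroll-mono {x = x} {y} _ _ (inj₂ x+k<v) (inj₁ (v<y , _)) (inj₂ y+k<x) =
    ⊥-elim (<-asym (m+n≤o⇒m≤o (suc y) y+k<x) (<-trans (m+n≤o⇒m≤o (suc x) x+k<v) v<y))
  unroll-mono _ _ (inj₂ _) (inj₂ _) (inj₁ (x<y , _)) = +-monoˡ-< _ x<y
  unroll-mono {x = x} {y} v<n _ (inj₂ x+k<v) (inj₂ _) (inj₂ y+k<x) =
    ⊥-elim (<⇒≱ (+-cancelʳ-< k x k (≤-trans x+k<v (≤-pred v<n))) (≤-trans (m≤n+m k y) (<⇒≤ y+k<x)))

  no-dominated-triangle : ∀ {v x y z} → T k ∶ v ⇒ x → T k ∶ v ⇒ y → T k ∶ v ⇒ z →
    T k ∶ x ⇒ y → T k ∶ y ⇒ z → ¬ (T k ∶ z ⇒ x)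
  no-dominated-triangle {v} {x} {y} {z} vx vy vz xy yz zx =
    <-irrefl refl (<-trans (mono {x} {y} vx vy xy) (<-trans (mono {y} {z} vy vz yz) (mono {z} {x} vz vx zx)))
    where
    mono : ∀ {x y} (p : T k ∶ v ⇒ x) (q : T k ∶ v ⇒ y) → T k ∶ x ⇒ y →
      unroll (edge⇒↷ {v} {x} p) < unroll (edge⇒↷ {v} {y} q)
    mono {x} {y} p q xy = unroll-mono (toℕ<n v) (toℕ<n x) (edge⇒↷ {v} {x} p) (edge⇒↷ {v} {y} q) (edge⇒↷ {x} {y} xy)

  -- Vertex 1 of U₅ dominates the triangle 0, 2, 3.
  U5-free : ¬ Hom U5 (T k)
  U5-free (f , fE) = no-dominated-triangle {f 1F} {f 0F} {f 2F} {f 3F}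
    (fE refl) (fE refl) (fE refl) (fE refl) (fE refl) (fE refl)

-- Parity and halving modulo 2k + 1

nonempty : ∀ {m} → Fin m → ∃ λ k → m ≡ suc k
nonempty zero    = _ , refl
nonempty (suc _) = _ , refl

even : ℕ → Bool
even zero    = true
even (suc m) = not (even m)

data Half : ℕ → Bool → Set where
  twice     : ∀ i → Half (i + i) true
  twice-suc : ∀ i → Half (suc (i + i)) false

half : ∀ m → Half m (even m)
half zero = twice 0
half (suc m) with even m | half m
... | true  | twice i     = twice-suc i
... | false | twice-suc i = subst (λ m → Half (suc m) true) (+-suc i i) (twice (suc i))

module _ (k : ℕ) where
  open Rotational k

  -- Multiplication by k + 1 modulo 2k + 1.
  place : ∀ {m b} → Half m b → ℕ
  place (twice i)     = i
  place (twice-suc i) = suc (k + i)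

  double-< : ∀ {i j} → i + i < j + j → i < j
  double-< {i} {j} lt = ≰⇒> λ j≤i → <⇒≱ lt (+-mono-≤ j≤i j≤i)

  double-≤ : ∀ {i j} → i + i ≤ j + j → i ≤ j
  double-≤ {i} {j} le = ≮⇒≥ λ j<i → <⇒≱ (+-mono-< j<i j<i) le

  place-bound : ∀ {m b} (h : Half m b) → m ≤ k + k → place h < suc (k + k)
  place-bound (twice i)     m≤ = s≤s (≤-trans (m≤m+n i i) m≤)
  place-bound (twice-suc i) m≤ = s≤s (+-monoʳ-< k (double-< m≤))

  -- An even rise m′ - m = 2d becomes a forward step of d, and 1 ≤ d ≤ k.
  place-same : ∀ {m m′ b} (h : Half m b) (h′ : Half m′ b) → m′ ≤ k + k → m < m′ → place h ↷ place h′
  place-same (twice i)     (twice j)     m′≤ lt = inj₁ (double-< lt , ≤-trans (double-≤ m′≤) (m≤n+m k i))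
  place-same (twice-suc i) (twice-suc j) m′≤ (s≤s lt) =
    inj₁ (s≤s (+-monoʳ-< k (double-< lt)) , s≤s (+-mono-≤ (m≤m+n k i) (double-≤ (<⇒≤ m′≤))))

  -- An odd drop m - m′ = 2d + 1 becomes a forward step of k - d modulo 2k + 1, again between 1 and
  -- k.
  place-diff : ∀ {m m′ b b′} (h : Half m b) (h′ : Half m′ b′) → b ≢ b′ → m ≤ k + k → m′ < m → place h ↷ place h′
  place-diff (twice i)     (twice j)     b≢b _ _ = ⊥-elim (b≢b refl)
  place-diff (twice-suc i) (twice-suc j) b≢b _ _ = ⊥-elim (b≢b refl)
  place-diff (twice i)     (twice-suc j) _ m≤ lt =
    inj₁ (s≤s (≤-trans (double-≤ m≤) (m≤m+n k j)) ,
          ≤-trans (≤-reflexive (trans (sym (+-suc k j)) (+-comm k (suc j)))) (+-monoˡ-≤ k (double-< (<⇒≤ lt))))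
  place-diff (twice-suc i) (twice j)     _ m≤ (s≤s lt) =
    inj₂ (s≤s (≤-trans (+-monoˡ-≤ k (double-≤ lt)) (≤-reflexive (+-comm i k))))

-- Locally transitive prime tournaments

module CyclicOrder (G : Digraph) (tour : IsTournament G) (prime : Prime G)
  (out-transitive : ∀ {w a b c} → Tournament.Cyc G tour a b c → G ∶ w ⇒ a → G ∶ w ⇒ b → G ∶ w ⇒ c → ⊥)
  (in-transitive  : ∀ {w a b c} → Tournament.Cyc G tour a b c → G ∶ a ⇒ w → G ∶ b ⇒ w → G ∶ c ⇒ w → ⊥)
  {v₀ v₁ v₂ : Fin (n G)} (triangle : Tournament.Cyc G tour v₀ v₁ v₂) where
  open Tournament G tour

  third-vertex : ∀ x y → ∃ λ z → z ≢ x × z ≢ y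
  third-vertex x y with any? (λ z → ¬? (z Fin.≟ x) ×-dec ¬? (z Fin.≟ y))
  ... | yes found = found
  ... | no none = ⊥-elim (pigeonhole (x-or-y v₀) (x-or-y v₁) (x-or-y v₂) triangle)
    where
    x-or-y : ∀ z → z ≡ x ⊎ z ≡ y
    x-or-y z with z Fin.≟ x | z Fin.≟ y
    ... | yes z≡x | _       = inj₁ z≡x
    ... | no _    | yes z≡y = inj₂ z≡y
    ... | no z≢x  | no z≢y  = ⊥-elim (none (z , z≢x , z≢y))
    pigeonhole : ∀ {a b c} → a ≡ x ⊎ a ≡ y → b ≡ x ⊎ b ≡ y → c ≡ x ⊎ c ≡ y → ¬ Cyc a b c
    pigeonhole (inj₁ refl) (inj₁ refl) _           (ab , _ , _) = irr ab
    pigeonhole (inj₂ refl) (inj₂ refl) _           (ab , _ , _) = irr ab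
    pigeonhole _           (inj₁ refl) (inj₁ refl) (_ , bc , _) = irr bc
    pigeonhole _           (inj₂ refl) (inj₂ refl) (_ , bc , _) = irr bc
    pigeonhole (inj₁ refl) _           (inj₁ refl) (_ , _ , ca) = irr ca
    pigeonhole (inj₂ refl) _           (inj₂ refl) (_ , _ , ca) = irr ca

  -- Twins form a homogeneous set of size two, which is nontrivial because `triangle` guarantees a
  -- third vertex.
  no-twins : ∀ {x y} → x ≢ y → ¬ (∀ v → v ≢ x → v ≢ y → (v ⇒ x × v ⇒ y) ⊎ (x ⇒ v × y ⇒ v))
  no-twins {x} {y} x≢y twins = prime X homogeneous
    ( subst (_< ∣ X ∣) (∣⁅x⁆∣≡1 x) (∣insert∣ λ y∈x → x≢y (sym (x∈⁅y⁆⇒x≡y x y∈x)))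
    , subst (∣ X ∣ <_) (∣⊤∣≡n (n G)) (p⊂q⇒∣p∣<∣q∣ (⊆⊤ , z , ∈⊤ , λ z∈ → z∉ (∈X z∈))) )
    where
    X = insert y ⁅ x ⁆
    z = proj₁ (third-vertex x y)
    ∈X : ∀ {v} → v ∈ X → v ≡ x ⊎ v ≡ y
    ∈X v∈ with ∈insert v∈
    ... | new = inj₂ refl
    ... | old v∈x = inj₁ (x∈⁅y⁆⇒x≡y x v∈x)
    z∉ : z ≡ x ⊎ z ≡ y → ⊥
    z∉ = [ proj₁ (proj₂ (third-vertex x y)) , proj₂ (proj₂ (third-vertex x y)) ]′
    homogeneous : Homogeneous G X
    homogeneous v v∉ with twins v (λ { refl → v∉ (⊆insert {y} {⁅ x ⁆} (x∈⁅x⁆ x)) })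
                              (λ { refl → v∉ (v∈insert {y} {⁅ x ⁆}) })
    ... | inj₁ (vx , vy) = inj₁ λ u u∈ → case ∈X u∈ of λ { (inj₁ refl) → vx ; (inj₂ refl) → vy }
    ... | inj₂ (xv , yv) = inj₂ λ u u∈ → case ∈X u∈ of λ { (inj₁ refl) → xv ; (inj₂ refl) → yv }

  opaque
    -- The value `true` marks the out-neighbourhood of v₀ together with v₀ itself, so that v₀
    -- becomes the least vertex of the order below.
    side : V → Bool
    side x with compare x v₀
    ... | bwd _  = true
    ... | same _ = true
    ... | fwd _  = false

    side-true : ∀ {x} → side x ≡ true → x ≡ v₀ ⊎ v₀ ⇒ x
    side-true {x} eq with compare x v₀
    ... | bwd e  = inj₂ e
    ... | same e = inj₁ e

    side-false : ∀ {x} → side x ≡ false → x ⇒ v₀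
    side-false {x} eq with compare x v₀
    ... | fwd e = e

    side-v₀ : side v₀ ≡ true
    side-v₀ with compare v₀ v₀
    ... | bwd _  = refl
    ... | same _ = refl
    ... | fwd e  = ⊥-elim (irr e)

  -- Reversing the edges between the out- and the in-neighbourhood of v₀ makes G transitive.
  infix 4 _≺_
  data _≺_ (x y : V) : Set where
    along   : side x ≡ side y → x ⇒ y → x ≺ y
    against : side x ≢ side y → y ⇒ x → x ≺ y

  ≺-total : ∀ {x y} → x ≢ y → x ≺ y ⊎ y ≺ x
  ≺-total {x} {y} x≢y with compare x y | side x Bool.≟ side y
  ... | same eq | _        = ⊥-elim (x≢y eq)
  ... | fwd xy  | yes s    = inj₁ (along s xy)
  ... | fwd xy  | no d     = inj₂ (against (d ∘ sym) xy)
  ... | bwd yx  | yes s    = inj₂ (along (sym s) yx)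
  ... | bwd yx  | no d     = inj₁ (against d yx)

  ≺-asym : ∀ {x y} → x ≺ y → ¬ (y ≺ x)
  ≺-asym (along _ xy)   (along _ yx)   = asym xy yx
  ≺-asym (along s _)    (against d _)  = d (sym s)
  ≺-asym (against d _)  (along s _)    = d (sym s)
  ≺-asym (against _ yx) (against _ xy) = asym xy yx

  ≺-irr : ∀ {x} → ¬ (x ≺ x)
  ≺-irr x≺x = ≺-asym x≺x x≺x

  -- Local transitivity at v₀ excludes triangles inside either neighbourhood, and v₀ has no
  -- in-neighbour on its own side.
  side-uniform : ∀ {x y z} → side x ≡ side y → side y ≡ side z → ¬ Cyc x y z
  side-uniform {x} {y} {z} xy yz cyc@(x⇒y , y⇒z , z⇒x) with side x in sx
  ... | false = in-transitive cyc (side-false sx) (side-false (sym xy)) (side-false (sym (trans xy yz)))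
  ... | true with side-true {x} sx | side-true {y} (sym xy) | side-true {z} (sym (trans xy yz))
  ...   | inj₂ x₀ | inj₂ y₀ | inj₂ z₀ = out-transitive cyc x₀ y₀ z₀
  ...   | inj₁ refl | inj₁ refl | _ = irr x⇒y
  ...   | _ | inj₁ refl | inj₁ refl = irr y⇒z
  ...   | inj₁ refl | _ | inj₁ refl = irr z⇒x
  ...   | inj₁ refl | inj₂ _ | inj₂ z₀ = asym z⇒x z₀
  ...   | inj₂ x₀ | inj₁ refl | inj₂ _ = asym x⇒y x₀
  ...   | inj₂ _ | inj₂ y₀ | inj₁ refl = asym y⇒z y₀

  -- If x and y are on the side of v₀, the triangle x z v₀ would dominate y; if they are on the
  -- other side, x would dominate the triangle z y v₀. When v₀ is one of the vertices, an edge has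
  -- the wrong direction.
  side-split : ∀ {x y z} → side x ≡ side y → side y ≢ side z → x ⇒ y → z ⇒ y → ¬ (x ⇒ z)
  side-split {x} {y} {z} xy yz x⇒y z⇒y x⇒z with side x in sx | side z in sz
  ... | true  | true  = yz (sym xy)
  ... | false | false = yz (sym xy)
  ... | true  | false with side-true {x} sx | side-true {y} (sym xy)
  ...   | inj₁ refl | _         = asym x⇒z (side-false sz)
  ...   | inj₂ x₀   | inj₁ refl = asym x⇒y x₀
  ...   | inj₂ x₀   | inj₂ y₀   = in-transitive (x⇒z , side-false sz , x₀) x⇒y z⇒y y₀
  side-split {x} {y} {z} xy yz x⇒y z⇒y x⇒z | false | true with side-true {z} sz
  ...   | inj₁ refl = asym z⇒y (side-false (sym xy))
  ...   | inj₂ z₀   = out-transitive (z⇒y , side-false (sym xy) , z₀) x⇒z x⇒y (side-false sx)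

  -- A closed walk changes sides an even number of times. No change is excluded by `side-uniform`,
  -- two changes by `side-split`.
  ≺-acyclic : ∀ {x y z} → x ≺ y → y ≺ z → ¬ (z ≺ x)
  ≺-acyclic (along s xy)   (along t yz)   (along _ zx)   = side-uniform s t (xy , yz , zx)
  ≺-acyclic (along s _)    (along t _)    (against d _)  = d (sym (trans s t))
  ≺-acyclic (along s _)    (against d _)  (along t _)    = d (trans (sym s) (sym t))
  ≺-acyclic (against d _)  (along s _)    (along t _)    = d (sym (trans s t))
  ≺-acyclic (along s xy)   (against d zy) (against _ xz) = side-split s d xy zy xz
  ≺-acyclic (against d yx) (along s yz)   (against e xz) = side-split s e yz xz yx
  ≺-acyclic (against d yx) (against e zy) (along s zx)   = side-split s d zx yx zy
  ≺-acyclic {x} {y} {z} (against d _) (against e _) (against f _) with side x | side y | side z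
  ... | true  | true  | _     = d refl
  ... | false | false | _     = d refl
  ... | _     | true  | true  = e refl
  ... | _     | false | false = e refl
  ... | true  | false | true  = f refl
  ... | false | true  | false = f refl

  ≺-trans : ∀ {x y z} → x ≺ y → y ≺ z → x ≺ z
  ≺-trans {x} {y} {z} xy yz with x Fin.≟ z
  ... | yes refl = ⊥-elim (≺-asym xy yz)
  ... | no x≢z with ≺-total x≢z
  ...   | inj₁ xz = xz
  ...   | inj₂ zx = ⊥-elim (≺-acyclic xy yz zx)

  _≺?_ : ∀ x y → Dec (x ≺ y)
  x ≺? y with x Fin.≟ y
  ... | yes refl = no ≺-irr
  ... | no x≢y with ≺-total x≢y
  ...   | inj₁ xy = yes xy
  ...   | inj₂ yx = no (≺-asym yx)

  v₀-least : ∀ {x} → x ≢ v₀ → v₀ ≺ x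
  v₀-least {x} x≢v₀ with side x in sx
  ... | false = against (λ eq → case trans (sym side-v₀) (trans eq sx) of λ ()) (side-false sx)
  ... | true with side-true {x} sx
  ...   | inj₁ x≡v₀ = ⊥-elim (x≢v₀ x≡v₀)
  ...   | inj₂ v₀x  = along (trans side-v₀ (sym sx)) v₀x

  -- Ranks in the linear order

  below : V → Subset (n G)
  below x = Vec.tabulate λ y → does (y ≺? x)

  ∈below : ∀ {x y} → y ≺ x → y ∈ below x
  ∈below {x} {y} yx = lookup⇒[]= y (below x) (trans (lookup∘tabulate _ y) (dec-true (y ≺? x) yx))

  below∈ : ∀ {x y} → y ∈ below x → y ≺ x
  below∈ {x} {y} y∈ with y ≺? x | trans (sym (lookup∘tabulate (λ y → does (y ≺? x)) y)) ([]=⇒lookup y∈)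
  ... | yes yx | _ = yx

  opaque
    rank : V → ℕ
    rank x = ∣ below x ∣

    rank-mono : ∀ {x y} → x ≺ y → rank x < rank y
    rank-mono xy = p⊂q⇒∣p∣<∣q∣ ((λ z∈ → ∈below (≺-trans (below∈ z∈) xy)) , _ , ∈below xy , ≺-irr ∘ below∈)

    rank<n : ∀ x → rank x < n G
    rank<n x = subst (rank x <_) (∣⊤∣≡n (n G)) (p⊂q⇒∣p∣<∣q∣ (⊆⊤ , x , ∈⊤ , ≺-irr ∘ below∈))

  rank-reflects : ∀ {x y} → rank x < rank y → x ≺ y
  rank-reflects {x} {y} lt with x Fin.≟ y
  ... | yes refl = ⊥-elim (<-irrefl refl lt)
  ... | no x≢y with ≺-total x≢y
  ...   | inj₁ xy = xy
  ...   | inj₂ yx = ⊥-elim (<-asym lt (rank-mono yx))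

  rank-injective : ∀ {x y} → rank x ≡ rank y → x ≡ y
  rank-injective {x} {y} eq with x Fin.≟ y
  ... | yes x≡y = x≡y
  ... | no x≢y with ≺-total x≢y
  ...   | inj₁ xy = ⊥-elim (<⇒≢ (rank-mono xy) eq)
  ...   | inj₂ yx = ⊥-elim (<⇒≢ (rank-mono yx) (sym eq))

  rank-surjective : ∀ {m} → m < n G → ∃ λ x → rank x ≡ m
  rank-surjective m<n =
    let x , eq = injective⇒surjective (λ x → fromℕ< (rank<n x))
          (λ {x} {y} eq → rank-injective (trans (sym (toℕ-fromℕ< (rank<n x)))
                                           (trans (cong toℕ eq) (toℕ-fromℕ< (rank<n y)))))
          ≤-refl (fromℕ< m<n)
    in x , trans (sym (toℕ-fromℕ< (rank<n x))) (trans (cong toℕ eq) (toℕ-fromℕ< m<n))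

  -- Vertices on the same side that are consecutive for ≺ are twins.
  consecutive : ∀ {x y} → rank y ≡ suc (rank x) → side y ≢ side x
  consecutive {x} {y} ry same-side = no-twins {x} {y} x≢y twins
    where
    x≢y : x ≢ y
    x≢y refl = <⇒≢ (n<1+n _) ry
    both-below : ∀ {v} → v ≺ x → v ≺ y → (v ⇒ x × v ⇒ y) ⊎ (x ⇒ v × y ⇒ v)
    both-below (along _ vx)   (along _ vy)   = inj₁ (vx , vy)
    both-below (against _ xv) (against _ yv) = inj₂ (xv , yv)
    both-below (along s _)    (against d _)  = ⊥-elim (d (trans s (sym same-side)))
    both-below (against d _)  (along s _)    = ⊥-elim (d (trans s same-side))
    both-above : ∀ {v} → x ≺ v → y ≺ v → (v ⇒ x × v ⇒ y) ⊎ (x ⇒ v × y ⇒ v)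
    both-above (along _ xv)   (along _ yv)   = inj₂ (xv , yv)
    both-above (against _ vx) (against _ vy) = inj₁ (vx , vy)
    both-above (along s _)    (against d _)  = ⊥-elim (d (trans same-side s))
    both-above (against d _)  (along s _)    = ⊥-elim (d (trans (sym same-side) s))
    twins : ∀ v → v ≢ x → v ≢ y → (v ⇒ x × v ⇒ y) ⊎ (x ⇒ v × y ⇒ v)
    twins v v≢x v≢y with ≺-total v≢x
    ... | inj₁ vx = both-below vx (≺-trans vx (rank-reflects (≤-reflexive (sym ry))))
    ... | inj₂ xv = both-above xv (rank-reflects
            (≤∧≢⇒< (subst (_≤ rank v) (sym ry) (rank-mono xv)) (λ eq → v≢y (rank-injective (sym eq)))))

  rank-zero : ∀ {x} → rank x ≡ 0 → x ≡ v₀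
  rank-zero {x} eq = decidable-stable (x Fin.≟ v₀) λ x≢v₀ →
    n≮0 (subst (rank v₀ <_) eq (rank-mono (v₀-least x≢v₀)))

  -- Rank 0 belongs to v₀, and sides change at every step by `consecutive`.
  side-rank : ∀ m {x} → rank x ≡ m → side x ≡ even m
  side-rank zero eq with rank-zero eq
  ... | refl = side-v₀
  side-rank (suc m) {x} eq with rank-surjective {m} (<-trans (n<1+n m) (subst (_< n G) eq (rank<n x)))
  ... | y , refl = trans (¬-not (consecutive eq)) (cong not (side-rank m refl))

  -- A last vertex z on the other side would be a twin of the first vertex v₀: for v between them
  -- exactly one of the two comparisons reverses an edge, so v sees both ends alike.
  greatest-side : ∀ {z} → (∀ {x} → x ≢ z → x ≺ z) → side z ≢ false
  greatest-side {z} greatest sz = no-twins {v₀} {z} v₀≢z λ v v≢v₀ v≢z → go (v₀-least v≢v₀) (greatest v≢z)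
    where
    v₀≢z : v₀ ≢ z
    v₀≢z refl = case trans (sym side-v₀) sz of λ ()
    go : ∀ {v} → v₀ ≺ v → v ≺ z → (v ⇒ v₀ × v ⇒ z) ⊎ (v₀ ⇒ v × z ⇒ v)
    go (along _ v₀v)   (against _ zv) = inj₂ (v₀v , zv)
    go (against _ vv₀) (along _ vz)   = inj₁ (vv₀ , vz)
    go (along s _)     (along t _)    = ⊥-elim (case trans (sym side-v₀) (trans s (trans t sz)) of λ ())
    go (against d _)   (against e _)  = ⊥-elim (d (trans side-v₀ (sym (trans (¬-not e) (cong not sz)))))

  -- The last vertex has rank `n G` - 1 and lies on the side of v₀, where ranks are even.
  n-odd : ∃ λ k → n G ≡ suc (k + k)
  n-odd with nonempty v₀
  ... | m , eq with rank-surjective {m} (subst (m <_) (sym eq) (n<1+n m))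
  ...   | z , rz = let k , m≡ = go (half m) (trans (sym (side-rank m rz))
                                                 (¬-not {side z} {false} (greatest-side greatest)))
                   in k , trans eq (cong suc m≡)
    where
    greatest : ∀ {x} → x ≢ z → x ≺ z
    greatest {x} x≢z = rank-reflects (≤∧≢⇒<
      (subst (rank x ≤_) (sym rz) (≤-pred (subst (rank x <_) eq (rank<n x)))) (x≢z ∘ rank-injective))
    go : ∀ {m b} → Half m b → b ≡ true → ∃ λ k → m ≡ k + k
    go (twice k) refl = k , refl

  -- The isomorphism with T_n

  module _ (k : ℕ) (n≡ : n G ≡ suc (k + k)) where
    open Rotational k

    rank≤ : ∀ x → rank x ≤ k + k
    rank≤ x = ≤-pred (subst (rank x <_) n≡ (rank<n x))
    f : V → Fin (suc (k + k))
    f x = fromℕ< (place-bound k (half (rank x)) (rank≤ x))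
    toℕ-f : ∀ x → toℕ (f x) ≡ place k (half (rank x))
    toℕ-f x = toℕ-fromℕ< (place-bound k (half (rank x)) (rank≤ x))
    -- Equal parity of ranks means equal sides, where edges go up in rank; between the sides they go
    -- down. These are the two cases of `place-same` and `place-diff`.
    ↷-f : ∀ {x y} → x ⇒ y → place k (half (rank x)) ↷ place k (half (rank y))
    ↷-f {x} {y} xy with even (rank x) Bool.≟ even (rank y)
    ... | yes s = place-same′ (half (rank x)) (half (rank y)) s (rank≤ y)
        (rank-mono (along (trans (side-rank _ refl) (trans s (sym (side-rank _ refl)))) xy))
      where
      place-same′ : ∀ {m m′ b b′} (h : Half m b) (h′ : Half m′ b′) → b ≡ b′ →
        m′ ≤ k + k → m < m′ → place k h ↷ place k h′
      place-same′ h h′ refl = place-same k h h′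
    ... | no d = place-diff k (half (rank x)) (half (rank y)) d (rank≤ x)
        (rank-mono (against (λ eq → d (trans (sym (side-rank _ refl)) (trans (sym eq) (side-rank _ refl)))) xy))
    hom : Hom G (T k)
    hom = f , λ {x} {y} xy → ↷⇒edge {f x} {f y} (subst₂ _↷_ (sym (toℕ-f x)) (sym (toℕ-f y)) (↷-f xy))
    embeds-f = hom-embeds {G} {T k} tour edge-asym hom

    isomorphic : G ≅ T k
    isomorphic = mk⤖ {to = f} (inj , surj) , proj₂ embeds-f
      where
      inj = proj₁ embeds-f
      surj : ∀ y → ∃ λ x → ∀ {z} → z ≡ x → f z ≡ y
      surj y with injective⇒surjective f inj (≤-reflexive (sym n≡)) y
      ... | x , eq = x , λ { refl → eq }

  isomorphic-T : ∃ λ k → G ≅ T k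
  isomorphic-T = map₂ (λ {k} → isomorphic k) n-odd

-- The classification

monochromatic-free : ∀ {A : Set} (c : A → Fin 3) k {x y z} → c x ≢ k → c y ≢ k → c z ≢ k →
  ¬ IsRainbow c x y z
monochromatic-free c k {x} {y} {z} x≢k y≢k z≢k (x≢y , y≢z , z≢x) =
  x≢y (third-unique k (c z) (c x) (c y) (z≢k ∘ sym) x≢k (z≢x ∘ sym) y≢k y≢z)

rev-prime : ∀ {G} → Prime G → Prime (Rev G)
rev-prime prime X homogeneous = prime X λ v v∉X → Sum.swap (homogeneous v v∉X)

module Classification (G : Digraph) (tour : IsTournament G) (prime : Prime G) (noU5 : ¬ Hom U5 G) where
  open Tournament G tour

  noD5 : ¬ Hom D5 G
  noD5 = prime⇒noD5 prime noU5

  triangle? : Dec (∃ λ a → ∃ λ b → ∃ λ c → Cyc a b c)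
  triangle? = any? λ a → any? λ b → any? λ c → (a ⇒? b) ×-dec (b ⇒? c) ×-dec (c ⇒? a)

  -- Makes the case distinction in `classify` constructive. The edges tested, from i to i + 1 and to
  -- i + 2, are all those of T₅.
  T5? : Dec (Hom (T 2) G)
  T5? = map′
    (λ (a , b , c , d , e , edges) → mkT5 G (quintuple a b c d e) edges)
    (λ (f , fE) → f 0F , f 1F , f 2F , f 3F , f 4F , λ where
      0F → fE refl , fE refl
      1F → fE refl , fE refl
      2F → fE refl , fE refl
      3F → fE refl , fE refl
      4F → fE refl , fE refl)
    (any? λ a → any? λ b → any? λ c → any? λ d → any? λ e →
      all? λ i → (quintuple a b c d e i ⇒? quintuple a b c d e (turn 1F i)) ×-dec
                 (quintuple a b c d e i ⇒? quintuple a b c d e (turn 2F i)))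
    where
    quintuple : V → V → V → V → V → Fin 5 → V
    quintuple a b c d e = Vec.lookup (a Vec.∷ b Vec.∷ c Vec.∷ d Vec.∷ e Vec.∷ Vec.[])

  -- In-neighbourhoods are transitive because the reversed tournament satisfies the same hypotheses.
  circular : Hom (T 2) G → ∃ λ k → G ≅ T k
  circular T5⊂G@(_ , fE) = CyclicOrder.isomorphic-T G tour prime
    (Circular.no-dominated-triangle G tour (noU5 ∷ noD5 ∷ []) prime T5⊂G)
    (λ (ab , bc , ca) aw bw cw → Circular.no-dominated-triangle (Rev G) (rev-tournament {G} tour)
      (rev-noU5 {G} noU5 ∷ rev-noD5 {G} noD5 ∷ []) (rev-prime {G} prime) (rev-T5 {G} T5⊂G)
      (ca , bc , ab) aw cw bw)
    (fE {0F} {1F} refl , fE {1F} {3F} refl , fE {3F} {0F} refl)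

  classify : (∃ λ k → G ≅ T k) ⊎
    ∃ λ (c : V → Fin 3) → ∀ k → TransitiveSet G (λ v → c v ≢ k)
  classify with triangle?
  -- Without triangles a single colour class is enough.
  ... | no none = inj₂ ((λ _ → 0F) , λ _ a b d _ _ _ abd → none (a , b , d , abd))
  ... | yes (_ , _ , _ , abd) with T5?
  ...   | yes T5⊂G = inj₁ (circular T5⊂G)
  ...   | no noT5 with Extension.colourable G tour noU5 noT5 noD5 prime abd
  ...     | c , rainbow = inj₂ (c , λ k x y z x≢k y≢k z≢k xyz →
              monochromatic-free c k {x} {y} {z} x≢k y≢k z≢k (rainbow xyz))

-- The converse direction

transitive⇒rainbow : ∀ {G} {c : Fin (n G) → Fin 3} → (∀ k → TransitiveSet G (λ v → c v ≢ k)) →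
  ∀ {x y z} → G ∶ x ⇒ y → G ∶ y ⇒ z → G ∶ z ⇒ x → IsRainbow c x y z
transitive⇒rainbow {G} {c} transitive xy yz zx = distinct xy yz zx , distinct yz zx xy , distinct zx xy yz
  where
  distinct : ∀ {x y z} → G ∶ x ⇒ y → G ∶ y ⇒ z → G ∶ z ⇒ x → c x ≢ c y
  -- If x and y had the same colour, the triangle would avoid some colour k entirely.
  distinct {x} {y} {z} xy yz zx x~y with third (c x) (c z)
  ... | k , k≢x , k≢z = transitive k x y z (k≢x ∘ sym) (λ y≡k → k≢x (sym (trans x~y y≡k))) (k≢z ∘ sym) (xy , yz , zx)

-- The triangles 4 1 2 and 4 1 3 of U₅ share an edge, which forces 2 and 3 to have the same colour;
-- but they also lie in the triangle 2 3 0.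
tripartite⇒noU5 : ∀ {G} {c : Fin (n G) → Fin 3} → (∀ k → TransitiveSet G (λ v → c v ≢ k)) → ¬ Hom U5 G
tripartite⇒noU5 {G} {c} transitive (f , fE) =
  proj₁ (rainbow 2F 3F 0F refl refl refl)
    (rainbow-twins c {f 4F} {f 1F} {f 2F} {f 3F} (rainbow 4F 1F 2F refl refl refl) (rainbow 4F 1F 3F refl refl refl))
  where
  rainbow : ∀ i j l → U5 ∶ i ⇒ j → U5 ∶ j ⇒ l → U5 ∶ l ⇒ i → IsRainbow c (f i) (f j) (f l)
  rainbow i j l ij jl li = transitive⇒rainbow {G} {c} transitive (fE ij) (fE jl) (fE li)

T⇒noU5 : ∀ {G} k → G ≅ T k → ¬ Hom U5 G
T⇒noU5 k (g , g-edges) (f , fE) =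
  Rotational.U5-free k (Bijection.to g ∘ f , λ ij → trans (sym (g-edges _ _)) (fE ij))

theorem1p1 : (G : Digraph) → IsTournament G → Prime G →
    (Free U5 G ⇔
    ((∃ λ (k : ℕ) → G ≅ T k) ⊎
    (Σ (Fin (n G) → Fin 3) λ c →
    TransitiveSet G (λ v → c v ≢ suc (suc zero)) ×
    TransitiveSet G (λ v → c v ≢ zero) ×
    TransitiveSet G (λ v → c v ≢ suc zero))))
theorem1p1 G tour prime = mk⇔
  (λ free → Sum.map₂ (λ (c , transitive) → c , transitive 2F , transitive 0F , transitive 1F)
    (Classification.classify G tour prime (free ∘ hom⇒contains {G} tour)))
  λ where
    (inj₁ (k , iso)) → T⇒noU5 {G} k iso ∘ contains⇒hom {G} {U5}
    (inj₂ (c , t₂ , t₀ , t₁)) →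
      tripartite⇒noU5 {G} {c} (λ { 0F → t₀ ; 1F → t₁ ; 2F → t₂ }) ∘ contains⇒hom {G} {U5}
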